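{- For any two positive integers $d$ and $n$, there exists a $d$-hypertree $T$ on $[n]$ with $\mu(T) \geq c_d\binom{n-1}{d}$, where $c_d = 16\cdot (48)^{ -3^{d-1}}$.
   Context: All chains are over $\mathbb{F}_2$ and identified with their supports (sets of simplices). A $d$-simplex is a $(d+1)$-element subset of $[n]$; $K_n^d$ denotes the set of all $d$-simplices on $[n]$. The boundary $\partial X$ of a set $X$ of $d$-simplices is the set of $(d-1)$-simplices contained in an odd number of members of $X$. A $d$-cycle is a set $Z$ with $\partial Z=\emptyset$. A $d$-forest is a set of $d$-simplices no nonempty subset of which is a $d$-cycle; a $d$-hypertree on $[n]$ is an inclusion-maximal $d$-forest in $K_n^d$. For a $d$-hypertree $T$ and $\sigma\in K_n^d$, $\mathrm{Fill}(\sigma,T)$ is the unique subset $F\subseteq T$ with $\partial F=\partial\sigma$. The average filling-volume is $\mu(T) = \binom{n}{d+1}^{ -1}\sum_{\sigma\in K_n^d}|\mathrm{Fill}(\sigma,T)|$. -}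

module Defs where

open import Data.Nat using (ℕ; zero; suc; _+_; _*_; _^_; _∸_; _≤_)
open import Data.Nat.Combinatorics using (_C_)
open import Data.Bool using (Bool; true; false; _∧_; _xor_; if_then_else_)
import Data.Bool as B
open import Data.List using (List; []; _∷_; map; filter; foldr; _++_)
open import Data.Nat.ListAction using (sum)
open import Data.Vec using (_∷_; [])
import Data.Vec.Properties as VP
open import Data.Fin.Subset using (Subset; inside; outside; ∣_∣; _⊆_)
open import Data.Fin.Subset.Properties using (_⊆?_)
open import Relation.Nullary using (¬_; ⌊_⌋)
open import Relation.Binary.PropositionalEquality using (_≡_)
open import Data.Product using (_×_; Σ; ∃)
import Data.Nat as N

subsets : (n : ℕ) → List (Subset n)
subsets zero    = [] ∷ []
subsets (suc n) = map (outside ∷_) (subsets n) ++ map (inside ∷_) (subsets n)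

K : (n d : ℕ) → List (Subset n)
K n d = filter (λ s → ∣ s ∣ N.≟ suc d) (subsets n)

IsSimplex : (n d : ℕ) → Subset n → Set
IsSimplex n d s = ∣ s ∣ ≡ suc d

-- A chain (over F₂) is identified with its support: a Boolean predicate on
-- subsets of [n].  A d-chain is one supported on d-simplices.
Chain : ℕ → Set
Chain n = Subset n → Bool

IsDChain : (n d : ℕ) → Chain n → Set
IsDChain n d X = ∀ s → X s ≡ true → IsSimplex n d s

_⊑_ : {n : ℕ} → Chain n → Chain n → Set
Y ⊑ X = ∀ s → Y s ≡ true → X s ≡ true

single : {n : ℕ} → Subset n → Chain n
single σ s = ⌊ VP.≡-dec B._≟_ s σ ⌋

parity : List Bool → Bool
parity = foldr _xor_ false

∂ : (n d : ℕ) → Chain n → Chain n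
∂ n d X τ = ⌊ ∣ τ ∣ N.≟ d ⌋ ∧ parity (map (λ σ → X σ ∧ ⌊ τ ⊆? σ ⌋) (K n d))

_≈_ : {n : ℕ} → Chain n → Chain n → Set
X ≈ Y = ∀ s → X s ≡ Y s

IsCycle : (n d : ℕ) → Chain n → Set
IsCycle n d Z = ∀ τ → ∂ n d Z τ ≡ false

Nonempty : {n : ℕ} → Chain n → Set
Nonempty X = ∃ λ s → X s ≡ true

IsForest : (n d : ℕ) → Chain n → Set
IsForest n d F = IsDChain n d F × (∀ Y → Y ⊑ F → Nonempty Y → ¬ IsCycle n d Y)

IsHypertree : (n d : ℕ) → Chain n → Set
IsHypertree n d T = IsForest n d T × (∀ F → T ⊑ F → IsForest n d F → F ⊑ T)

size : (n d : ℕ) → Chain n → ℕ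
size n d X = sum (map (λ σ → if X σ then 1 else 0) (K n d))

IsFill : (n d : ℕ) → Chain n → (Subset n → Chain n) → Set
IsFill n d T fill = ∀ σ → IsSimplex n d σ → (fill σ ⊑ T) × (∂ n d (fill σ) ≈ ∂ n d (single σ))

totalFill : (n d : ℕ) → (Subset n → Chain n) → ℕ
totalFill n d fill = sum (map (λ σ → size n d (fill σ)) (K n d))

{-# OPTIONS --safe #-}

-- Put the vertices in order.  If every vertex has, among the smaller vertices, a (d-1)-hypertree
-- as link, these cones form a d-hypertree, and fillings are computed from the top vertex down.
--
-- Induction on d, starting with the path.  Let G be a good (d-1)-hypertree on the first third [m]
-- of the vertices.  Averaging over all relabellings H of G, choose one for which the sum over
-- α ∈ G of |cut(α)| |Fill(α, H)| is at least the square of the total filling volume of G divided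
-- by C(m, d); here cut(α) = {τ : α ∈ Fill(τ, G)}.  Keep the m - 1 best simplices α ∈ G, and give
-- each its own vertex u_α in the second third, whose link contains H.  Let Q be G with every α
-- subdivided by u_α, and let the links of the vertices x of the last third contain Q.  If
-- α ∈ Fill(τ, G), then ∂α is the link of u_α in τ + Fill(τ, Q), and so Fill(x * τ) contains
-- u_α * Fill(α, H).  Summing over x, τ and α gives order n^(2d+1).
--
-- A d-hypertree is a Tree n (d + 1).  New vertices are added at the head of the Boolean vectors,
-- hence the top vertex is the first entry.
module Submission where

open import Defs
open import Data.Nat using (ℕ; zero; suc; _+_; _*_; _^_; _∸_; _≤_; _<_; z≤n; s≤s; s≤s⁻¹; _≡ᵇ_; >-nonZero)
open import Data.Nat.Properties
open import Algebra.Properties.CommutativeSemigroup +-commutativeSemigroup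
  using () renaming (interchange to +-interchange)
open import Data.Nat.Combinatorics using (_C_; nCk+nC[k+1]≡[n+1]C[k+1]; nC1≡n)
open import Data.Nat.DivMod using (_/_; _%_; m≡m%n+[m/n]*n; m%n<n)
open import Data.Nat.ListAction using (sum)
open import Data.Nat.ListAction.Properties using (sum-++)
open import Data.Nat.Tactic.RingSolver using (solve-∀)
open import Data.Bool using (Bool; true; false; _∧_; _xor_; if_then_else_)
import Data.Bool as Bool
open import Data.Bool.Properties
  using (xor-assoc; xor-comm; xor-same; xor-identityʳ; ∧-zeroʳ; ∧-identityʳ; ¬-not)
open import Data.Bool.Solver using (module xor-∧-Solver)
open xor-∧-Solver using (solve; _:+_; _:=_)
open import Data.Product using (Σ; _×_; _,_; proj₁; proj₂; ∃)
open import Data.Sum using (_⊎_; inj₁; inj₂)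
open import Data.Empty using (⊥; ⊥-elim)
open import Data.Fin.Subset using (Subset; ∣_∣; inside; outside)
open import Data.Fin.Subset.Properties using (_⊆?_)
open import Data.Vec using ([]; _∷_)
open import Data.Vec.Properties using (∷-injectiveʳ; ≡-dec)
open import Data.List using (List; []; _∷_; map; _++_; length; cartesianProductWith; filter)
open import Data.List.Properties using (map-++; map-∘; map-cong)
open import Data.List.Relation.Unary.All using (All; []; _∷_; universal)
open import Data.List.Relation.Unary.All.Properties using () renaming (map⁺ to All-map⁺; ++⁺ to All-++⁺)
open import Data.List.Relation.Unary.AllPairs using ([]; _∷_)
import Data.List.Relation.Unary.AllPairs.Properties as AllPairs
open import Data.List.Relation.Unary.Unique.Propositional using (Unique)
import Data.List.Relation.Unary.Unique.Propositional.Properties as Unique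
open import Data.List.Relation.Binary.Sublist.Propositional using (_⊆_; []; _∷_; _∷ʳ_; ⊆-refl; ⊆-trans)
open import Data.List.Relation.Binary.Sublist.Propositional.Properties using (All-resp-⊆)
open import Function using (_∘_; id; case_of_)
open import Relation.Nullary using (yes; no; ⌊_⌋; contradiction; does)
open import Relation.Nullary.Decidable using (isYes≗does)
open import Relation.Unary using (Decidable)
open import Relation.Binary.PropositionalEquality

private variable
  n m k : ℕ
  I I′ I″ : Set

-- Sums over the k-element subsets of [n]

∑ : ℕ → (Subset n → ℕ) → ℕ
∑ {zero}  zero    f = f []
∑ {zero}  (suc k) f = 0
∑ {suc n} zero    f = ∑ 0 (f ∘ (outside ∷_))
∑ {suc n} (suc k) f = ∑ (suc k) (f ∘ (outside ∷_)) + ∑ k (f ∘ (inside ∷_))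

∑-cong : ∀ k {f g : Subset n → ℕ} → (∀ s → ∣ s ∣ ≡ k → f s ≡ g s) → ∑ k f ≡ ∑ k g
∑-cong {zero}  zero    p = p [] refl
∑-cong {zero}  (suc k) p = refl
∑-cong {suc n} zero    p = ∑-cong 0 (λ s → p (outside ∷ s))
∑-cong {suc n} (suc k) p =
  cong₂ _+_ (∑-cong (suc k) (λ s → p (outside ∷ s))) (∑-cong k (λ s e → p (inside ∷ s) (cong suc e)))

∑-mono : ∀ k {f g : Subset n → ℕ} → (∀ s → ∣ s ∣ ≡ k → f s ≤ g s) → ∑ k f ≤ ∑ k g
∑-mono {zero}  zero    p = p [] refl
∑-mono {zero}  (suc k) p = z≤n
∑-mono {suc n} zero    p = ∑-mono 0 (λ s → p (outside ∷ s))
∑-mono {suc n} (suc k) p =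
  +-mono-≤ (∑-mono (suc k) (λ s → p (outside ∷ s))) (∑-mono k (λ s e → p (inside ∷ s) (cong suc e)))

∑-zero : ∀ k → ∑ {n} k (λ _ → 0) ≡ 0
∑-zero {zero}  zero    = refl
∑-zero {zero}  (suc k) = refl
∑-zero {suc n} zero    = ∑-zero {n} 0
∑-zero {suc n} (suc k) = cong₂ _+_ (∑-zero {n} (suc k)) (∑-zero {n} k)

∑-+ : ∀ k (f g : Subset n → ℕ) → ∑ k (λ s → f s + g s) ≡ ∑ k f + ∑ k g
∑-+ {zero}  zero    f g = refl
∑-+ {zero}  (suc k) f g = refl
∑-+ {suc n} zero    f g = ∑-+ {n} 0 _ _
∑-+ {suc n} (suc k) f g =
  trans (cong₂ _+_ (∑-+ {n} (suc k) _ _) (∑-+ {n} k _ _)) (+-interchange (∑ {n} (suc k) _) _ _ _)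

∑-*ˡ : ∀ k c (f : Subset n → ℕ) → ∑ k (λ s → c * f s) ≡ c * ∑ k f
∑-*ˡ {zero}  zero    c f = refl
∑-*ˡ {zero}  (suc k) c f = sym (*-zeroʳ c)
∑-*ˡ {suc n} zero    c f = ∑-*ˡ {n} 0 c _
∑-*ˡ {suc n} (suc k) c f =
  trans (cong₂ _+_ (∑-*ˡ {n} (suc k) c _) (∑-*ˡ {n} k c _)) (sym (*-distribˡ-+ c (∑ {n} (suc k) _) _))

∑-*ʳ : ∀ k c (f : Subset n → ℕ) → ∑ k (λ s → f s * c) ≡ ∑ k f * c
∑-*ʳ k c f = trans (∑-cong k (λ s _ → *-comm (f s) c)) (trans (∑-*ˡ k c f) (*-comm c _))

∑-swap : ∀ k l (F : Subset n → Subset m → ℕ) → ∑ k (λ s → ∑ l (F s)) ≡ ∑ l (λ t → ∑ k (λ s → F s t))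
∑-swap {zero}  zero    l F = refl
∑-swap {zero} {m} (suc k) l F = sym (∑-zero {m} l)
∑-swap {suc n} zero    l F = ∑-swap {n} 0 l (F ∘ (outside ∷_))
∑-swap {suc n} {m} (suc k) l F =
  trans (cong₂ _+_ (∑-swap {n} (suc k) l (F ∘ (outside ∷_))) (∑-swap {n} k l (F ∘ (inside ∷_))))
        (sym (∑-+ {m} l (λ t → ∑ (suc k) (λ s → F (outside ∷ s) t)) (λ t → ∑ k (λ s → F (inside ∷ s) t))))

∑-one : ∀ k → ∑ {n} k (λ _ → 1) ≡ n C k
∑-one {zero}  zero    = refl
∑-one {zero}  (suc k) = refl
∑-one {suc n} zero    = ∑-one {n} 0
∑-one {suc n} (suc k) =
  trans (cong₂ _+_ (∑-one {n} (suc k)) (∑-one {n} k))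
        (trans (+-comm (n C suc k) (n C k)) (nCk+nC[k+1]≡[n+1]C[k+1] n k))

∑-const : ∀ k c → ∑ {n} k (λ _ → c) ≡ c * (n C k)
∑-const {n} k c =
  trans (∑-cong {n} k (λ _ _ → sym (*-identityʳ c))) (trans (∑-*ˡ {n} k c (λ _ → 1)) (cong (c *_) (∑-one k)))

-- Chains

ι : Bool → ℕ
ι b = if b then 1 else 0

𝟘 : Chain n
𝟘 _ = false

infixl 6 _⊕_
_⊕_ : Chain n → Chain n → Chain n
(X ⊕ Y) s = X s xor Y s

infixr 7 _·_
_·_ : Bool → Chain n → Chain n
(b · X) s = b ∧ X s

⟨_,_⟩ : Chain n → Chain n → Chain (suc n)
⟨ X , Y ⟩ (outside ∷ s) = X s
⟨ X , Y ⟩ (inside  ∷ s) = Y s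

deletion link : Chain (suc n) → Chain n
deletion X s = X (outside ∷ s)
link     X s = X (inside ∷ s)

vol : ℕ → Chain n → ℕ
vol k X = ∑ k (λ s → ι (X s))

vol-cong : ∀ k {X Y : Chain n} → X ≈ Y → vol k X ≡ vol k Y
vol-cong k e = ∑-cong k (λ s _ → cong ι (e s))

≈-sym : {X Y : Chain n} → X ≈ Y → Y ≈ X
≈-sym e s = sym (e s)

≈-trans : {X Y Z : Chain n} → X ≈ Y → Y ≈ Z → X ≈ Z
≈-trans e f s = trans (e s) (f s)

⊕-cong : {X X′ Y Y′ : Chain n} → X ≈ X′ → Y ≈ Y′ → (X ⊕ Y) ≈ (X′ ⊕ Y′)
⊕-cong e f s = cong₂ _xor_ (e s) (f s)

⊕-≈𝟘 : {X Y : Chain n} → (X ⊕ Y) ≈ 𝟘 → X ≈ Y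
⊕-≈𝟘 {X = X} {Y} e s with X s | Y s | e s
... | false | false | _ = refl
... | true  | true  | _ = refl
... | false | true  | ()
... | true  | false | ()

≈⇒⊕≈𝟘 : {X Y : Chain n} → X ≈ Y → (X ⊕ Y) ≈ 𝟘
≈⇒⊕≈𝟘 {X = X} {Y} e s = trans (cong (_xor Y s) (e s)) (xor-same (Y s))

xor-true : ∀ {a b} → a xor b ≡ true → a ≡ true ⊎ b ≡ true
xor-true {true}  _ = inj₁ refl
xor-true {false} e = inj₂ e

∧-true : ∀ {a b} → a ∧ b ≡ true → a ≡ true × b ≡ true
∧-true {true} e = refl , e

false≢true : ∀ {a} → a ≡ false → a ≡ true → ⊥
false≢true refl ()

⊕-⊑ : {X Y Z : Chain n} → X ⊑ Z → Y ⊑ Z → (X ⊕ Y) ⊑ Z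
⊕-⊑ p q s e with xor-true e
... | inj₁ x = p s x
... | inj₂ y = q s y

xor-interchange : ∀ a b c d → (a xor b) xor (c xor d) ≡ (a xor c) xor (b xor d)
xor-interchange = solve 4 (λ a b c d → (a :+ b) :+ (c :+ d) := (a :+ c) :+ (b :+ d)) refl

-- Dimension-free boundary: for chains of d-simplices it agrees with ∂ n d.
bd : Chain n → Chain n
bd {zero}  X []            = false
bd {suc n} X (outside ∷ s) = bd (deletion X) s xor X (inside ∷ s)
bd {suc n} X (inside  ∷ s) = bd (link X) s

bd-cong : {X Y : Chain n} → X ≈ Y → bd X ≈ bd Y
bd-cong {zero}  e []            = refl
bd-cong {suc n} e (outside ∷ s) = cong₂ _xor_ (bd-cong (e ∘ (outside ∷_)) s) (e (inside ∷ s))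
bd-cong {suc n} e (inside  ∷ s) = bd-cong (e ∘ (inside ∷_)) s

bd-⊕ : (X Y : Chain n) → bd (X ⊕ Y) ≈ (bd X ⊕ bd Y)
bd-⊕ {zero}  X Y []            = refl
bd-⊕ {suc n} X Y (outside ∷ s) =
  trans (cong (_xor (X (inside ∷ s) xor Y (inside ∷ s))) (bd-⊕ (deletion X) (deletion Y) s))
        (xor-interchange (bd (deletion X) s) (bd (deletion Y) s) _ _)
bd-⊕ {suc n} X Y (inside  ∷ s) = bd-⊕ (link X) (link Y) s

bd-𝟘 : bd {n} 𝟘 ≈ 𝟘
bd-𝟘 {zero}  []            = refl
bd-𝟘 {suc n} (outside ∷ s) = trans (xor-identityʳ _) (bd-𝟘 s)
bd-𝟘 {suc n} (inside  ∷ s) = bd-𝟘 s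

bd-· : ∀ b (X : Chain n) → bd (b · X) ≈ (b · bd X)
bd-· false X = bd-𝟘
bd-· true  X s = refl

-- The deletion of `bd X` is `bd (deletion X) ⊕ link X` and its link is `bd (link X)`. By linearity
-- `bd (link X)` occurs twice and cancels, and the rest is the induction hypothesis.
bd-bd : (X : Chain n) → bd (bd X) ≈ 𝟘
bd-bd {zero}  X []            = refl
bd-bd {suc n} X (outside ∷ s) = ≈⇒⊕≈𝟘
  (≈-trans (bd-⊕ (bd (deletion X)) (link X)) (⊕-cong {Y = bd (link X)} (bd-bd (deletion X)) (λ _ → refl))) s
bd-bd {suc n} X (inside  ∷ s) = bd-bd (link X) s

Cycle : Chain n → Set
Cycle X = bd X ≈ 𝟘

⊕-cycle : {X Y : Chain n} → Cycle X → Cycle Y → Cycle (X ⊕ Y)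
⊕-cycle {X = X} {Y} p q = ≈-trans (bd-⊕ X Y) (⊕-cong p q)

·-cycle : ∀ b {X : Chain n} → Cycle X → Cycle (b · X)
·-cycle false p = bd-𝟘
·-cycle true  p = p

Uniform : ℕ → Chain n → Set
Uniform k X = ∀ s → X s ≡ true → ∣ s ∣ ≡ k

-- Predecessor-free form of Uniform (k - 1): no set satisfies it when k = 0.
Below : ℕ → Chain n → Set
Below k X = ∀ s → X s ≡ true → suc ∣ s ∣ ≡ k

-- The offset `j` counts the top vertices already stripped off, so that the induction can pass from
-- a chain to its link.
bd-card : ∀ j k {X : Chain n} → (∀ s → X s ≡ true → j + ∣ s ∣ ≡ k) → ∀ t → bd X t ≡ true → j + suc ∣ t ∣ ≡ k
bd-card j k p [] ()
bd-card j k p (outside ∷ t) e with xor-true e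
... | inj₁ x = bd-card j k (p ∘ (outside ∷_)) t x
... | inj₂ x = p (inside ∷ t) x
bd-card j k p (inside ∷ t) e =
  trans (+-suc j (suc ∣ t ∣)) (bd-card (suc j) k (λ s x → trans (sym (+-suc j ∣ s ∣)) (p (inside ∷ s) x)) t e)

bd-below : {X : Chain n} → Uniform k X → Below k (bd X)
bd-below {k = k} = bd-card 0 k

⊕-uniform : {X Y : Chain n} → Uniform k X → Uniform k Y → Uniform k (X ⊕ Y)
⊕-uniform p q s e with xor-true e
... | inj₁ x = p s x
... | inj₂ y = q s y

·-uniform : ∀ b {X : Chain n} → Uniform k X → Uniform k (b · X)
·-uniform true p = p

uniform-below : {X : Chain n} → Uniform k X → Below (suc k) X
uniform-below p s e = cong suc (p s e)

δ : Subset n → Chain n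
δ []            []            = true
δ (outside ∷ σ) (outside ∷ s) = δ σ s
δ (outside ∷ σ) (inside  ∷ s) = false
δ (inside  ∷ σ) (outside ∷ s) = false
δ (inside  ∷ σ) (inside  ∷ s) = δ σ s

δ-refl : (σ : Subset n) → δ σ σ ≡ true
δ-refl []            = refl
δ-refl (outside ∷ σ) = δ-refl σ
δ-refl (inside  ∷ σ) = δ-refl σ

δ⇒≡ : (σ s : Subset n) → δ σ s ≡ true → s ≡ σ
δ⇒≡ []            []            _ = refl
δ⇒≡ (outside ∷ σ) (outside ∷ s) e = cong (outside ∷_) (δ⇒≡ σ s e)
δ⇒≡ (inside  ∷ σ) (inside  ∷ s) e = cong (inside ∷_) (δ⇒≡ σ s e)

δ-uniform : (σ : Subset n) → ∣ σ ∣ ≡ k → Uniform k (δ σ)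
δ-uniform σ p s e = trans (cong ∣_∣ (δ⇒≡ σ s e)) p

δ≡false : (σ s : Subset n) → s ≢ σ → δ σ s ≡ false
δ≡false σ s p = ¬-not (p ∘ δ⇒≡ σ s)

vol-δ : (σ : Subset n) → vol ∣ σ ∣ (δ σ) ≡ 1
vol-δ []            = refl
vol-δ {suc n} (outside ∷ σ) with ∣ σ ∣ | vol-δ σ
... | zero  | e = e
... | suc k | e = trans (cong (vol (suc k) (δ σ) +_) (∑-zero {n} k)) (trans (+-identityʳ _) e)
vol-δ {suc n} (inside  ∷ σ) = cong₂ _+_ (∑-zero {n} (suc ∣ σ ∣)) (vol-δ σ)

-- Hypertrees

-- This is the size of the star of one vertex. For `k = 0` the value is 0, because under `bd` the
-- empty set alone is already a cycle.
treeSize : ℕ → ℕ → ℕ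
treeSize n zero    = 0
treeSize n (suc k) = (n ∸ 1) C k

-- fill z is meaningful only for cycles z of (k - 1)-element sets.
record Tree (n k : ℕ) : Set where
  field
    has     : Chain n
    uniform : Uniform k has
    fill    : Chain n → Chain n
    fill⊑   : ∀ {z} → Below k z → Cycle z → fill z ⊑ has
    bd-fill : ∀ {z} → Below k z → Cycle z → bd (fill z) ≈ z
    free    : ∀ {Y} → Y ⊑ has → Cycle Y → Y ≈ 𝟘
    count   : vol k has ≡ treeSize n k

  fill-unique : ∀ {z F} → Below k z → Cycle z → F ⊑ has → bd F ≈ z → F ≈ fill z
  fill-unique {z} {F} bz cz F⊑ e =
    ⊕-≈𝟘 (free (⊕-⊑ {X = F} F⊑ (fill⊑ bz cz))
               (≈-trans (bd-⊕ F (fill z)) (≈⇒⊕≈𝟘 (≈-trans e (≈-sym (bd-fill bz cz))))))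

  fill-cong : ∀ {z w} → Below k z → Cycle z → z ≈ w → fill z ≈ fill w
  fill-cong {z} {w} bz cz e =
    fill-unique (λ s q → bz s (trans (e s) q)) (≈-trans (bd-cong (≈-sym e)) cz)
                (fill⊑ bz cz) (≈-trans (bd-fill bz cz) e)

  fill-uniform : ∀ {z} → Below k z → Cycle z → Uniform k (fill z)
  fill-uniform bz cz s e = uniform s (fill⊑ bz cz s e)

  fillσ : Subset n → Chain n
  fillσ σ = fill (bd (δ σ))

  total : ℕ
  total = ∑ k (λ σ → vol k (fillσ σ))

  module _ (σ : Subset n) (p : ∣ σ ∣ ≡ k) where
    σ-below : Below k (bd (δ σ))
    σ-below = bd-below (δ-uniform σ p)

    fillσ⊑ : fillσ σ ⊑ has
    fillσ⊑ = fill⊑ σ-below (bd-bd (δ σ))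

    bd-fillσ : bd (fillσ σ) ≈ bd (δ σ)
    bd-fillσ = bd-fill σ-below (bd-bd (δ σ))

    fillσ-uniform : Uniform k (fillσ σ)
    fillσ-uniform = fill-uniform σ-below (bd-bd (δ σ))

    fundamental-cycle : Cycle (δ σ ⊕ fillσ σ)
    fundamental-cycle = ≈-trans (bd-⊕ (δ σ) (fillσ σ)) (≈⇒⊕≈𝟘 (≈-sym bd-fillσ))

    fundamental-uniform : Uniform k (δ σ ⊕ fillσ σ)
    fundamental-uniform = ⊕-uniform (δ-uniform σ p) fillσ-uniform

open Tree

empty : ∀ n → Tree n 0
empty n = record
  { has = 𝟘 ; uniform = λ _ () ; fill = λ _ → 𝟘 ; fill⊑ = λ _ _ _ ()
  ; bd-fill = λ {z} b _ s → trans (bd-𝟘 s) (sym (¬-not (λ e → case b s e of λ ())))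
  ; free = λ {Y} p _ s → ¬-not (λ e → case p s e of λ ())
  ; count = ∑-zero {n} 0 }

-- The cone from the top vertex over the part of a cycle avoiding that vertex is a filling: its
-- boundary is right off the top vertex by construction, and at the top vertex because the given
-- chain is a cycle.
star : ∀ n k → Tree (suc n) (suc k)
star n k = record
  { has     = ⟨ 𝟘 , all ⟩
  ; uniform = λ { (inside ∷ s) e → cong suc (all-card s e) }
  ; fill    = λ z → ⟨ 𝟘 , deletion z ⟩
  ; fill⊑   = λ { b _ (inside ∷ s) e → card-all s (suc-injective (b (outside ∷ s) e)) }
  ; bd-fill = λ { {z} b c (outside ∷ s) → cong (_xor z (outside ∷ s)) (bd-𝟘 s)
                ; {z} b c (inside ∷ s) → ⊕-≈𝟘 {X = bd (deletion z)} {link z} (c ∘ (outside ∷_)) s }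
  ; free    = λ {Y} p c → λ
      { (outside ∷ s) → Y-out Y p s
      ; (inside ∷ s) → trans (cong (_xor Y (inside ∷ s)) (sym (trans (bd-cong (Y-out Y p) s) (bd-𝟘 s))))
                             (c (outside ∷ s)) }
  ; count   = trans (cong₂ _+_ (∑-zero {n} (suc k))
                (∑-cong {n} k (λ s e → cong ι (card-all s e)))) (∑-one {n} k) }
  where
  all : Chain n
  all s = ⌊ ∣ s ∣ ≟ k ⌋
  all-card : ∀ s → all s ≡ true → ∣ s ∣ ≡ k
  all-card s e with ∣ s ∣ ≟ k
  ... | yes p = p
  card-all : ∀ s → ∣ s ∣ ≡ k → all s ≡ true
  card-all s p with ∣ s ∣ ≟ k
  ... | yes _ = refl
  ... | no ¬p = contradiction p ¬p
  Y-out : ∀ Y → Y ⊑ ⟨ 𝟘 , all ⟩ → ∀ s → Y (outside ∷ s) ≡ false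
  Y-out Y p s = ¬-not (λ e → case p (outside ∷ s) e of λ ())

someTree : ∀ n k → Tree (suc n) k
someTree n zero    = empty (suc n)
someTree n (suc k) = star n k

-- This is Pascal's rule. The trees exclude `n = 0` for those small `k` at which the truncated
-- `n ∸ 1` would spoil it.
treeSize-suc : Tree n (suc k) → Tree n k → treeSize n (suc k) + treeSize n k ≡ treeSize (suc n) (suc k)
treeSize-suc {suc n} {zero}        T S = +-identityʳ _
treeSize-suc {suc n} {suc k}       T S = trans (+-comm (n C suc k) (n C k)) (nCk+nC[k+1]≡[n+1]C[k+1] n k)
treeSize-suc {zero}  {zero}        T S = case count T of λ ()
treeSize-suc {zero}  {suc zero}    T S = case count S of λ ()
treeSize-suc {zero}  {suc (suc k)} T S = refl

-- A filling of `z` is forced from the top down: its link must fill `link z` in `S`. Adding this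
-- link to `deletion z` leaves a cycle without the top vertex, to be filled in `T`.
extend : Tree n (suc k) → Tree n k → Tree (suc n) (suc k)
extend {n} {k} T S = record
  { has     = ⟨ has T , has S ⟩
  ; uniform = λ { (outside ∷ s) → uniform T s ; (inside ∷ s) e → cong suc (uniform S s e) }
  ; fill    = λ z → ⟨ fill T (rest z) , fill S (link z) ⟩
  ; fill⊑   = λ { b c (outside ∷ s) → fill⊑ T (rest-below b c) (rest-cycle b c) s
                ; b c (inside ∷ s) → fill⊑ S (link-below b) (c ∘ (inside ∷_)) s }
  ; bd-fill = λ { {z} b c (outside ∷ s) → trans
                    (cong (_xor fill S (link z) s) (bd-fill T (rest-below b c) (rest-cycle b c) s))
                    (trans (xor-assoc (z (outside ∷ s)) _ _)
                    (trans (cong (z (outside ∷ s) xor_) (xor-same (fill S (link z) s))) (xor-identityʳ _)))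
                ; b c (inside ∷ s) → bd-fill S (link-below b) (c ∘ (inside ∷_)) s }
  ; free    = λ {Y} p c → λ
      { (outside ∷ s) → free T (p ∘ (outside ∷_))
          (λ t → trans (sym (xor-identityʳ _))
            (trans (cong (bd (deletion Y) t xor_) (sym (free-link p c t))) (c (outside ∷ t)))) s
      ; (inside ∷ s) → free-link p c s }
  ; count   = trans (cong₂ _+_ (count T) (count S)) (treeSize-suc T S) }
  where
  rest : Chain (suc n) → Chain n
  rest z = deletion z ⊕ fill S (link z)
  link-below : ∀ {z} → Below (suc k) z → Below k (link z)
  link-below b s e = suc-injective (b (inside ∷ s) e)
  rest-below : ∀ {z} → Below (suc k) z → Cycle z → Below (suc k) (rest z)
  rest-below b c s e with xor-true e
  ... | inj₁ x = b (outside ∷ s) x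
  ... | inj₂ x = cong suc (fill-uniform S (link-below b) (c ∘ (inside ∷_)) s x)
  rest-cycle : ∀ {z} → Below (suc k) z → Cycle z → Cycle (rest z)
  rest-cycle {z} b c s = trans (bd-⊕ (deletion z) _ s)
    (trans (cong (bd (deletion z) s xor_) (bd-fill S (link-below b) (c ∘ (inside ∷_)) s)) (c (outside ∷ s)))
  free-link : ∀ {Y} → Y ⊑ ⟨ has T , has S ⟩ → Cycle Y → link Y ≈ 𝟘
  free-link p c = free S (p ∘ (inside ∷_)) (c ∘ (inside ∷_))

-- This is the basis exchange of a matroid, along the circuit `C` of `T` and `β`. A filling that
-- uses `α` is rerouted by adding `C`, which removes `α` and brings in `β`.
exchange : (T : Tree n k) {C : Chain n} {α β : Subset n} → Cycle C → (∀ s → C s ≡ true → s ≢ β → has T s ≡ true) →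
           C α ≡ true → C β ≡ true → has T α ≡ true → has T β ≡ false → ∣ β ∣ ≡ k → Tree n k
exchange {n} {k} T {C} {α} {β} cC C⊑ Cα Cβ Tα Tβ cardβ = record
  { has     = T⁺
  ; uniform = ⊕-uniform (⊕-uniform (uniform T) (δ-uniform α (uniform T α Tα))) (δ-uniform β cardβ)
  ; fill    = fill⁺
  ; fill⊑   = fill⁺⊑
  ; bd-fill = λ {z} b c s → trans (bd-⊕ (fill T z) _ s)
      (trans (cong₂ _xor_ (bd-fill T b c s) (·-cycle (fill T z α) cC s)) (xor-identityʳ _))
  ; free    = free⁺
  ; count   = +-cancelʳ-≡ 1 (vol k T⁺) (treeSize n k) (begin
      vol k T⁺ + 1               ≡⟨ cong (vol k T⁺ +_) (δ-count α (uniform T α Tα)) ⟨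
      vol k T⁺ + vol k (δ α)     ≡⟨ ∑-+ {n} k _ _ ⟨
      ∑ k (λ s → ι (T⁺ s) + ι (δ α s)) ≡⟨ ∑-cong {n} k (λ s _ → balance s) ⟩
      ∑ k (λ s → ι (has T s) + ι (δ β s)) ≡⟨ ∑-+ {n} k _ _ ⟩
      vol k (has T) + vol k (δ β) ≡⟨ cong₂ _+_ (count T) (δ-count β cardβ) ⟩
      treeSize n k + 1 ∎) }
  where
  open ≡-Reasoning
  T⁺ : Chain n
  T⁺ = has T ⊕ δ α ⊕ δ β
  fill⁺ : Chain n → Chain n
  fill⁺ z = fill T z ⊕ fill T z α · C
  δ-count : ∀ (σ : Subset n) → ∣ σ ∣ ≡ k → vol k (δ σ) ≡ 1
  δ-count σ refl = vol-δ σ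
  α≢β : α ≢ β
  α≢β refl = false≢true Tβ Tα
  T⁺-other : ∀ s → s ≢ α → s ≢ β → T⁺ s ≡ has T s
  T⁺-other s p q rewrite δ≡false α s p | δ≡false β s q = trans (xor-identityʳ _) (xor-identityʳ _)
  T⁺α : T⁺ α ≡ false
  T⁺α rewrite Tα | δ-refl α | δ≡false β α α≢β = refl
  balance : ∀ s → ι (T⁺ s) + ι (δ α s) ≡ ι (has T s) + ι (δ β s)
  balance s with δ α s in eα | δ β s in eβ
  ... | true  | true  = ⊥-elim (α≢β (trans (sym (δ⇒≡ α s eα)) (δ⇒≡ β s eβ)))
  ... | true  | false rewrite δ⇒≡ α s eα | Tα = refl
  ... | false | true  rewrite δ⇒≡ β s eβ | Tβ = refl
  ... | false | false with has T s
  ... | true  = refl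
  ... | false = refl
  fill⁺⊑ : ∀ {z} → Below k z → Cycle z → fill⁺ z ⊑ T⁺
  fill⁺⊑ {z} b c s e with δ α s in eα | δ β s in eβ
  ... | true  | _     = ⊥-elim (false≢true (cancel (δ⇒≡ α s eα)) e)
    where
    cancel : s ≡ α → fill⁺ z s ≡ false
    cancel refl = trans (cong (λ b → fill T z s xor (fill T z s ∧ b)) Cα)
                        (trans (cong (fill T z s xor_) (∧-identityʳ _)) (xor-same (fill T z s)))
  ... | false | true  rewrite δ⇒≡ β s eβ | Tβ = refl
  ... | false | false = trans (trans (xor-identityʳ _) (xor-identityʳ _)) (inT (xor-true e))
    where
    inT : fill T z s ≡ true ⊎ (fill T z α ∧ C s) ≡ true → has T s ≡ true
    inT (inj₁ x) = fill⊑ T b c s x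
    inT (inj₂ x) = C⊑ s (proj₂ (∧-true {fill T z α} x))
                        (λ { refl → false≢true eβ (δ-refl s) })
  free⁺ : ∀ {Y} → Y ⊑ T⁺ → Cycle Y → Y ≈ 𝟘
  free⁺ {Y} p c s = trans (sym (xor-identityʳ _)) (trans (cong (λ b → Y s xor (b ∧ C s)) (sym Yβ)) (Y′≈𝟘 s))
    where
    Y′ = Y ⊕ Y β · C
    Yα : Y α ≡ false
    Yα = ¬-not (λ e → false≢true T⁺α (p α e))
    Y′⊑ : Y′ ⊑ has T
    Y′⊑ s e with δ β s in eβ
    ... | true = ⊥-elim (false≢true (cancel (δ⇒≡ β s eβ)) e)
      where
      cancel : s ≡ β → Y′ s ≡ false
      cancel refl = trans (cong (λ b → Y s xor (Y s ∧ b)) Cβ)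
                          (trans (cong (Y s xor_) (∧-identityʳ _)) (xor-same (Y s)))
    ... | false with xor-true e
    ... | inj₁ x = trans (sym (T⁺-other s (λ { refl → false≢true Yα x }) s≢β)) (p s x)
      where
      s≢β : s ≢ β
      s≢β refl = false≢true eβ (δ-refl s)
    ... | inj₂ x = C⊑ s (proj₂ (∧-true {Y β} x)) (λ { refl → false≢true eβ (δ-refl s) })
    Y′≈𝟘 : Y′ ≈ 𝟘
    Y′≈𝟘 = free T Y′⊑ (⊕-cycle c (·-cycle (Y β) cC))
    -- Since `Y′` vanishes, `Y` equals `Y β · C`. At `α` the chain `C` is true while `Y` is false,
    -- whence `Y β` is false.
    Yβ : Y β ≡ false
    Yβ = trans (sym (trans (cong₂ (λ a b → a xor (Y β ∧ b)) Yα Cα) (∧-identityʳ _))) (Y′≈𝟘 α)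

-- Relabelling of the vertices

-- A permutation of the vertices is represented by its action on subsets, together with the
-- invariance of cardinality, boundary and sums. All instances below are composed of `lift` and
-- `swap`.
record Aut (n : ℕ) : Set where
  field
    to from : Subset n → Subset n
    to-from : ∀ s → to (from s) ≡ s
    from-to : ∀ s → from (to s) ≡ s
    card-to : ∀ s → ∣ to s ∣ ≡ ∣ s ∣
    bd-to   : ∀ X → bd (X ∘ to) ≈ (bd X ∘ to)
    ∑-to    : ∀ k f → ∑ k (f ∘ to) ≡ ∑ k f

  card-from : ∀ s → ∣ from s ∣ ≡ ∣ s ∣
  card-from s = trans (sym (card-to (from s))) (cong ∣_∣ (to-from s))

  bd-from : ∀ X → bd (X ∘ from) ≈ (bd X ∘ from)
  bd-from X s = trans (cong (bd (X ∘ from)) (sym (to-from s)))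
    (trans (sym (bd-to (X ∘ from) (from s))) (bd-cong (λ t → cong X (from-to t)) (from s)))

  δ-from : ∀ σ → (δ σ ∘ from) ≈ δ (to σ)
  δ-from σ s with δ (to σ) s in e
  ... | true rewrite δ⇒≡ (to σ) s e | from-to σ = δ-refl σ
  ... | false = δ≡false σ (from s) λ q → false≢true e
    (trans (cong (δ (to σ)) (trans (sym (to-from s)) (cong to q))) (δ-refl (to σ)))

open Aut

idᴬ : Aut n
idᴬ = record
  { to = id ; from = id ; to-from = λ _ → refl ; from-to = λ _ → refl ; card-to = λ _ → refl
  ; bd-to = λ _ _ → refl ; ∑-to = λ _ _ → refl }

infixr 9 _∘ᴬ_
_∘ᴬ_ : Aut n → Aut n → Aut n
φ ∘ᴬ ψ = record
  { to      = to φ ∘ to ψ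
  ; from    = from ψ ∘ from φ
  ; to-from = λ s → trans (cong (to φ) (to-from ψ (from φ s))) (to-from φ s)
  ; from-to = λ s → trans (cong (from ψ) (from-to φ (to ψ s))) (from-to ψ s)
  ; card-to = λ s → trans (card-to φ (to ψ s)) (card-to ψ s)
  ; bd-to   = λ X s → trans (bd-to ψ (X ∘ to φ) s) (bd-to φ X (to ψ s))
  ; ∑-to    = λ k f → trans (∑-to ψ k (f ∘ to φ)) (∑-to φ k f) }

mapTail : (Subset n → Subset n) → Subset (suc n) → Subset (suc n)
mapTail g (b ∷ s) = b ∷ g s

lift : Aut n → Aut (suc n)
lift φ = record
  { to      = mapTail (to φ)
  ; from    = mapTail (from φ)
  ; to-from = λ { (b ∷ s) → cong (b ∷_) (to-from φ s) }
  ; from-to = λ { (b ∷ s) → cong (b ∷_) (from-to φ s) }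
  ; card-to = λ { (outside ∷ s) → card-to φ s ; (inside ∷ s) → cong suc (card-to φ s) }
  ; bd-to   = λ { X (outside ∷ s) → cong (_xor X (inside ∷ to φ s)) (bd-to φ (deletion X) s)
                ; X (inside ∷ s) → bd-to φ (link X) s }
  ; ∑-to    = λ { zero f → ∑-to φ 0 (f ∘ (outside ∷_))
                ; (suc k) f → cong₂ _+_ (∑-to φ (suc k) (f ∘ (outside ∷_))) (∑-to φ k (f ∘ (inside ∷_))) } }

swapHead : Subset (suc (suc n)) → Subset (suc (suc n))
swapHead (a ∷ b ∷ s) = b ∷ a ∷ s

swap : Aut (suc (suc n))
swap {n} = record
  { to      = swapHead
  ; from    = swapHead
  ; to-from = λ { (a ∷ b ∷ s) → refl }
  ; from-to = λ { (a ∷ b ∷ s) → refl }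
  ; card-to = λ { (outside ∷ outside ∷ s) → refl ; (outside ∷ inside ∷ s) → refl
                ; (inside ∷ outside ∷ s) → refl ; (inside ∷ inside ∷ s) → refl }
  ; bd-to   = λ { X (outside ∷ outside ∷ s) → swap-last (bd (deletion (deletion X)) s) _ _
                ; X (outside ∷ inside ∷ s) → refl
                ; X (inside ∷ outside ∷ s) → refl
                ; X (inside ∷ inside ∷ s) → refl }
  ; ∑-to    = λ { zero f → refl
                ; (suc zero) f → swap-last+ (∑ {n} 1 _) _ _
                ; (suc (suc k)) f → +-interchange (∑ {n} (suc (suc k)) _) _ _ _ } }
  where
  swap-last : ∀ a b c → (a xor b) xor c ≡ (a xor c) xor b
  swap-last a b c = trans (xor-assoc a b c) (trans (cong (a xor_) (xor-comm b c)) (sym (xor-assoc a c b)))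
  swap-last+ : ∀ a b c → (a + b) + c ≡ (a + c) + b
  swap-last+ a b c = trans (+-assoc a b c) (trans (cong (a +_) (+-comm b c)) (sym (+-assoc a c b)))

relabel : Tree n k → Aut n → Tree n k
relabel {n} {k} T φ = record
  { has     = has T ∘ to φ
  ; uniform = λ s e → trans (sym (card-to φ s)) (uniform T (to φ s) e)
  ; fill    = λ z → fill T (z ∘ from φ) ∘ to φ
  ; fill⊑   = λ b c s → fill⊑ T (below b) (cycle c) (to φ s)
  ; bd-fill = λ {z} b c s → trans (bd-to φ (fill T (z ∘ from φ)) s)
                (trans (bd-fill T (below b) (cycle c) (to φ s)) (cong z (from-to φ s)))
  ; free    = λ {Y} p c s → trans (cong Y (sym (from-to φ s)))
                (free T {Y ∘ from φ} (λ t e → trans (cong (has T) (sym (to-from φ t))) (p (from φ t) e))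
                      (cycle c) (to φ s))
  ; count   = trans (∑-to φ k (ι ∘ has T)) (count T) }
  where
  below : ∀ {z} → Below k z → Below k (z ∘ from φ)
  below b s e = trans (cong suc (sym (card-from φ s))) (b (from φ s) e)
  cycle : ∀ {z : Chain n} → Cycle z → Cycle (z ∘ from φ)
  cycle {z} c s = trans (bd-from φ z s) (c (from φ s))

vol-fillσ-relabel : (T : Tree n k) (φ : Aut n) (σ : Subset n) → ∣ σ ∣ ≡ k →
                    vol k (fillσ (relabel T φ) σ) ≡ vol k (fillσ T (to φ σ))
vol-fillσ-relabel {k = k} T φ σ p =
  trans (∑-to φ k (ι ∘ fill T (bd (δ σ) ∘ from φ)))
        (vol-cong k (≈-sym (fill-cong T (σ-below T (to φ σ) q) (bd-bd (δ (to φ σ)))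
          (λ s → trans (bd-cong (≈-sym (δ-from φ σ)) s) (bd-from φ (δ σ) s)))))
  where
  q : ∣ to φ σ ∣ ≡ k
  q = trans (card-to φ σ) p

-- Averaging over all relabellings

∑ᴸ : {I : Set} → List I → (I → ℕ) → ℕ
∑ᴸ xs f = sum (map f xs)

∑ᴸ-cong : (xs : List I) {f g : I → ℕ} → (∀ x → f x ≡ g x) → ∑ᴸ xs f ≡ ∑ᴸ xs g
∑ᴸ-cong xs e = cong sum (map-cong e xs)

∑ᴸ-++ : (xs ys : List I) (f : I → ℕ) → ∑ᴸ (xs ++ ys) f ≡ ∑ᴸ xs f + ∑ᴸ ys f
∑ᴸ-++ xs ys f = trans (cong sum (map-++ f xs ys)) (sum-++ (map f xs) (map f ys))

∑ᴸ-map : (h : I → I′) (xs : List I) (f : I′ → ℕ) → ∑ᴸ (map h xs) f ≡ ∑ᴸ xs (f ∘ h)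
∑ᴸ-map h xs f = cong sum (sym (map-∘ xs))

∑ᴸ-+ : (xs : List I) (f g : I → ℕ) → ∑ᴸ xs (λ x → f x + g x) ≡ ∑ᴸ xs f + ∑ᴸ xs g
∑ᴸ-+ []       f g = refl
∑ᴸ-+ (x ∷ xs) f g = trans (cong (f x + g x +_) (∑ᴸ-+ xs f g)) (+-interchange (f x) (g x) _ _)

∑ᴸ-*ˡ : ∀ c (xs : List I) (f : I → ℕ) → ∑ᴸ xs (λ x → c * f x) ≡ c * ∑ᴸ xs f
∑ᴸ-*ˡ c []       f = sym (*-zeroʳ c)
∑ᴸ-*ˡ c (x ∷ xs) f = trans (cong (c * f x +_) (∑ᴸ-*ˡ c xs f)) (sym (*-distribˡ-+ c (f x) _))

∑ᴸ-const : ∀ (xs : List I) c → ∑ᴸ xs (λ _ → c) ≡ length xs * c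
∑ᴸ-const []       c = refl
∑ᴸ-const (x ∷ xs) c = cong (c +_) (∑ᴸ-const xs c)

∑ᴸ-∑ : ∀ k (xs : List I) (F : I → Subset n → ℕ) → ∑ᴸ xs (λ x → ∑ k (F x)) ≡ ∑ k (λ s → ∑ᴸ xs (λ x → F x s))
∑ᴸ-∑ {n = n} k []       F = sym (∑-zero {n} k)
∑ᴸ-∑ {n = n} k (x ∷ xs) F = trans (cong (∑ k (F x) +_) (∑ᴸ-∑ k xs F)) (sym (∑-+ {n} k _ _))

∑ᴸ-product : (_⊗_ : I → I′ → I″) (xs : List I) (ys : List I′) (f : I″ → ℕ) →
             ∑ᴸ (cartesianProductWith _⊗_ xs ys) f ≡ ∑ᴸ ys (λ y → ∑ᴸ xs (λ x → f (x ⊗ y)))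
∑ᴸ-product _⊗_ []       ys f = trans (sym (*-zeroʳ (length ys))) (sym (∑ᴸ-const ys 0))
∑ᴸ-product _⊗_ (x ∷ xs) ys f =
  trans (∑ᴸ-++ (map (x ⊗_) ys) _ f)
  (trans (cong₂ _+_ (∑ᴸ-map (x ⊗_) ys f) (∑ᴸ-product _⊗_ xs ys f)) (sym (∑ᴸ-+ ys _ _)))

∃≥average : (h : I → ℕ) (x : I) (xs : List I) (c : ℕ) → length (x ∷ xs) * c ≤ ∑ᴸ (x ∷ xs) h → ∃ λ y → c ≤ h y
∃≥average h x xs c le with c ≤? h x
... | yes p = x , p
∃≥average h x []       c le | no ¬p = contradiction (subst₂ _≤_ (+-identityʳ c) (+-identityʳ (h x)) le) ¬p
∃≥average h x (y ∷ xs) c le | no ¬p =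
  ∃≥average h y xs c (+-cancelˡ-≤ c _ _ (≤-trans le (+-monoˡ-≤ _ (<⇒≤ (≰⇒> ¬p)))))

-- The relabellings moving the first vertex to some position and keeping the order of the others
insertions : ∀ n → List (Aut (suc n))
insertions zero    = idᴬ ∷ []
insertions (suc n) = idᴬ ∷ map (λ φ → lift φ ∘ᴬ swap) (insertions n)

-- All n! permutations: the vertices below the top one are permuted first, then the top one is
-- inserted among them.
relabellings : ∀ n → List (Aut n)
relabellings zero    = idᴬ ∷ []
relabellings (suc n) = cartesianProductWith (λ φ ψ → φ ∘ᴬ lift ψ) (insertions n) (relabellings n)

∑ins : (Subset (suc n) → ℕ) → Subset (suc n) → ℕ
∑ins {n} f s = ∑ᴸ (insertions n) (λ φ → f (to φ s))

∑rel : (Subset n → ℕ) → Subset n → ℕ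
∑rel {n} f s = ∑ᴸ (relabellings n) (λ φ → f (to φ s))

∑ins-step : (f : Subset (suc (suc n)) → ℕ) → ∀ b c s →
            ∑ins f (b ∷ c ∷ s) ≡ f (b ∷ c ∷ s) + ∑ins (f ∘ (c ∷_)) (b ∷ s)
∑ins-step {n} f b c s = cong (f (b ∷ c ∷ s) +_) (∑ᴸ-map _ (insertions n) _)

∑ins-+ : (f g : Subset (suc n) → ℕ) → ∀ s → ∑ins (λ t → f t + g t) s ≡ ∑ins f s + ∑ins g s
∑ins-+ {n} f g s = ∑ᴸ-+ (insertions n) _ _

∑ins-cong : {f g : Subset (suc n) → ℕ} → (∀ s → f s ≡ g s) → ∀ s → ∑ins f s ≡ ∑ins g s
∑ins-cong {n} e s = ∑ᴸ-cong (insertions n) (λ φ → e (to φ s))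

∑rel-step : (f : Subset (suc n) → ℕ) → ∀ b s → ∑rel f (b ∷ s) ≡ ∑rel (λ t → ∑ins f (b ∷ t)) s
∑rel-step {n} f b s = ∑ᴸ-product _ (insertions n) (relabellings n) _

∑rel-cong : {f g : Subset n → ℕ} → (∀ s → f s ≡ g s) → ∀ s → ∑rel f s ≡ ∑rel g s
∑rel-cong {n} e s = ∑ᴸ-cong (relabellings n) (λ φ → e (to φ s))

-- Both sides run over all ways of inserting the two entries `b` and `c` into the vector `s`; only
-- the order of the two insertions differs.
∑ins-comm : (f : Subset (suc (suc n)) → ℕ) → ∀ b c s →
            ∑ins (λ t → ∑ins f (b ∷ t)) (c ∷ s) ≡ ∑ins (λ t → ∑ins f (c ∷ t)) (b ∷ s)
∑ins-comm {zero} f b c [] =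
  trans (+-identityʳ _) (trans (expand b c) (trans (+-comm (f (b ∷ c ∷ [])) _)
  (trans (sym (expand c b)) (sym (+-identityʳ _)))))
  where
  expand : ∀ b c → ∑ins f (b ∷ c ∷ []) ≡ f (b ∷ c ∷ []) + f (c ∷ b ∷ [])
  expand b c = trans (∑ins-step f b c []) (cong (f (b ∷ c ∷ []) +_) (+-identityʳ _))
∑ins-comm {suc n} f b c (d ∷ s) =
  trans (expand b c) (trans (swap-sum (f (b ∷ c ∷ d ∷ s)) (f (c ∷ b ∷ d ∷ s)) _ _ _ _ (∑ins-comm (f ∘ (d ∷_)) b c s))
  (sym (expand c b)))
  where
  -- The terms are sorted by which of the two entries stand before `d`: both, in either order, only
  -- `c`, only `b`, or neither.
  expand : ∀ b c → ∑ins (λ t → ∑ins f (b ∷ t)) (c ∷ d ∷ s) ≡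
    (f (b ∷ c ∷ d ∷ s) + (f (c ∷ b ∷ d ∷ s) + ∑ins (λ t → f (c ∷ d ∷ t)) (b ∷ s))) +
    (∑ins (λ t → f (b ∷ d ∷ t)) (c ∷ s) + ∑ins (λ t → ∑ins (f ∘ (d ∷_)) (b ∷ t)) (c ∷ s))
  expand b c = trans (∑ins-step (λ t → ∑ins f (b ∷ t)) c d s)
    (cong₂ _+_ (trans (∑ins-step f b c (d ∷ s)) (cong (f (b ∷ c ∷ d ∷ s) +_) (∑ins-step (f ∘ (c ∷_)) b d s)))
               (trans (∑ins-cong (λ t → ∑ins-step f b d t) (c ∷ s))
                      (∑ins-+ (λ t → f (b ∷ d ∷ t)) (λ t → ∑ins (f ∘ (d ∷_)) (b ∷ t)) (c ∷ s))))
  swap-sum : ∀ x y p q r r′ → r ≡ r′ → (x + (y + p)) + (q + r) ≡ (y + (x + q)) + (p + r′)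
  swap-sum x y p q r _ refl = begin
    (x + (y + p)) + (q + r) ≡⟨ cong (_+ (q + r)) (+-assoc x y p) ⟨
    (x + y + p) + (q + r)   ≡⟨ +-interchange (x + y) p q r ⟩
    (x + y + q) + (p + r)   ≡⟨ cong (λ w → w + q + (p + r)) (+-comm x y) ⟩
    (y + x + q) + (p + r)   ≡⟨ cong (_+ (p + r)) (+-assoc y x q) ⟩
    (y + (x + q)) + (p + r) ∎
    where open ≡-Reasoning

removeElement : (s : Subset (suc n)) → ∣ s ∣ ≡ suc k → Σ (Subset n) λ t → ∣ t ∣ ≡ k
removeElement         (inside  ∷ s)           e = s , suc-injective e
removeElement {suc n} (outside ∷ s)           e with removeElement s e
... | t , p = outside ∷ t , p
removeElement {zero}  (outside ∷ [])          ()

∑rel-swap : (f : Subset (suc (suc n)) → ℕ) → ∀ b c s → ∑rel f (b ∷ c ∷ s) ≡ ∑rel f (c ∷ b ∷ s)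
∑rel-swap f b c s = trans (expand b c) (trans (∑rel-cong (∑ins-comm f b c) s) (sym (expand c b)))
  where
  expand : ∀ b c → ∑rel f (b ∷ c ∷ s) ≡ ∑rel (λ t → ∑ins (λ u → ∑ins f (b ∷ u)) (c ∷ t)) s
  expand b c = trans (∑rel-step f b (c ∷ s)) (∑rel-step (λ u → ∑ins f (b ∷ u)) c s)

Constant : ℕ → Set
Constant n = (f : Subset n → ℕ) → ∀ s t → ∣ s ∣ ≡ ∣ t ∣ → ∑rel f s ≡ ∑rel f t

∑rel-tails : Constant n → (f : Subset (suc n) → ℕ) → ∀ b s t → ∣ s ∣ ≡ ∣ t ∣ → ∑rel f (b ∷ s) ≡ ∑rel f (b ∷ t)
∑rel-tails constant f b s t e =
  trans (∑rel-step f b s) (trans (constant (λ u → ∑ins f (b ∷ u)) s t e) (sym (∑rel-step f b t)))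

-- The tails may be replaced by others of the same cardinality. Choose them to start with `outside`
-- and `inside` respectively and to agree afterwards; then the two vectors differ by an exchange of
-- the top two entries.
∑rel-heads : Constant n → (f : Subset (suc n) → ℕ) → ∀ s t → suc ∣ s ∣ ≡ ∣ t ∣ →
             ∑rel f (inside ∷ s) ≡ ∑rel f (outside ∷ t)
∑rel-heads {zero}  _        f [] [] ()
∑rel-heads {suc n} constant f s  t  e with removeElement t (sym e)
... | u , p = trans (∑rel-tails constant f inside s (outside ∷ u) (sym p))
             (trans (∑rel-swap f inside outside u)
                    (∑rel-tails constant f outside (inside ∷ u) t (trans (cong suc p) e)))

∑rel-constant : Constant n
∑rel-constant {zero}  f []            []            e = refl
∑rel-constant {suc n} f (inside  ∷ s) (inside  ∷ t) e = ∑rel-tails (∑rel-constant {n}) f inside s t (suc-injective e)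
∑rel-constant {suc n} f (outside ∷ s) (outside ∷ t) e = ∑rel-tails (∑rel-constant {n}) f outside s t e
∑rel-constant {suc n} f (inside  ∷ s) (outside ∷ t) e = ∑rel-heads (∑rel-constant {n}) f s t e
∑rel-constant {suc n} f (outside ∷ s) (inside  ∷ t) e = sym (∑rel-heads (∑rel-constant {n}) f t s (sym e))

-- The sum over the relabellings takes one value on all `k`-element sets, and each relabelling
-- permutes these sets, so summing over the sets as well counts in two ways.
∑rel-average : ∀ k (f : Subset n → ℕ) s → ∣ s ∣ ≡ k → ∑rel f s * (n C k) ≡ length (relabellings n) * ∑ k f
∑rel-average {n} k f s p = begin
  ∑rel f s * (n C k)        ≡⟨ ∑-const {n} k (∑rel f s) ⟨
  ∑ {n} k (λ _ → ∑rel f s)  ≡⟨ ∑-cong k (λ t q → ∑rel-constant f s t (trans p (sym q))) ⟩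
  ∑ k (∑rel f)              ≡⟨ ∑ᴸ-∑ k (relabellings n) (λ φ → f ∘ to φ) ⟨
  ∑ᴸ (relabellings n) (λ φ → ∑ k (f ∘ to φ)) ≡⟨ ∑ᴸ-cong (relabellings n) (λ φ → ∑-to φ k f) ⟩
  ∑ᴸ (relabellings n) (λ _ → ∑ k f) ≡⟨ ∑ᴸ-const (relabellings n) (∑ k f) ⟩
  length (relabellings n) * ∑ k f ∎
  where open ≡-Reasoning

-- For each fixed `s` the average of `g (to φ s)` over all relabellings is the average of `g`. Hence
-- the average of the sum on the right already attains the bound, and some `φ` reaches the average.
goodRelabelling : ∀ k (f g : Subset n → ℕ) →
  Σ (Aut n) λ φ → ∑ k f * ∑ k g ≤ ∑ k (λ s → f s * g (to φ s)) * (n C k)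
goodRelabelling {n} k f g = choose (relabellings n) refl
  where
  open ≡-Reasoning
  h : Aut n → ℕ
  h φ = ∑ k (λ s → f s * g (to φ s)) * (n C k)
  average : ∑ᴸ (relabellings n) h ≡ length (relabellings n) * (∑ k f * ∑ k g)
  average = begin
    ∑ᴸ (relabellings n) h
      ≡⟨ ∑ᴸ-cong (relabellings n) (λ φ → sym (∑-*ʳ {n} k (n C k) (λ s → f s * g (to φ s)))) ⟩
    ∑ᴸ (relabellings n) (λ φ → ∑ k (λ s → f s * g (to φ s) * (n C k)))
      ≡⟨ ∑ᴸ-∑ {n = n} k (relabellings n) (λ φ s → f s * g (to φ s) * (n C k)) ⟩
    ∑ k (λ s → ∑ᴸ (relabellings n) (λ φ → f s * g (to φ s) * (n C k)))
      ≡⟨ ∑-cong k (λ s p → trans (∑ᴸ-cong (relabellings n)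
             (λ φ → trans (*-assoc (f s) _ _) (cong (f s *_) (*-comm (g (to φ s)) _))))
           (trans (∑ᴸ-*ˡ (f s) (relabellings n) _) (cong (f s *_)
           (trans (∑ᴸ-*ˡ (n C k) (relabellings n) _) (trans (*-comm (n C k) _) (∑rel-average k g s p)))))) ⟩
    ∑ k (λ s → f s * (length (relabellings n) * ∑ k g))
      ≡⟨ ∑-*ʳ k _ f ⟩
    ∑ k f * (length (relabellings n) * ∑ k g)
      ≡⟨ *-assoc (∑ k f) (length (relabellings n)) (∑ k g) ⟨
    ∑ k f * length (relabellings n) * ∑ k g
      ≡⟨ cong (_* ∑ k g) (*-comm (∑ k f) (length (relabellings n))) ⟩
    length (relabellings n) * ∑ k f * ∑ k g
      ≡⟨ *-assoc (length (relabellings n)) (∑ k f) (∑ k g) ⟩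
    length (relabellings n) * (∑ k f * ∑ k g) ∎
  choose : ∀ xs → relabellings n ≡ xs → Σ (Aut n) λ φ → ∑ k f * ∑ k g ≤ h φ
  choose (x ∷ xs) e = ∃≥average h x xs _ (≤-reflexive (trans (cong (λ ys → length ys * (∑ k f * ∑ k g)) (sym e))
                        (trans (sym average) (cong (λ ys → ∑ᴸ ys h) e))))
  choose [] e = ⊥-elim (nonempty n e)
    where
    nonempty : ∀ n → relabellings n ≢ []
    nonempty zero    ()
    nonempty (suc n) e with relabellings n in eq
    nonempty (suc zero) () | x ∷ xs
    nonempty (suc (suc n)) () | x ∷ xs
    nonempty (suc n) e | [] = nonempty n eq

-- Embedding into a larger vertex set

up : ∀ i → Subset m → Subset (i + m)
up zero    s = s
up (suc i) s = outside ∷ up i s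

upᶜ : ∀ i → Chain m → Chain (i + m)
upᶜ zero    X = X
upᶜ (suc i) X = ⟨ upᶜ i X , 𝟘 ⟩

card-up : ∀ i (s : Subset m) → ∣ up i s ∣ ≡ ∣ s ∣
card-up zero    s = refl
card-up (suc i) s = card-up i s

upᶜ-up : ∀ i (X : Chain m) s → upᶜ i X (up i s) ≡ X s
upᶜ-up zero    X s = refl
upᶜ-up (suc i) X s = upᶜ-up i X s

upᶜ-⊑ : ∀ i {X : Chain m} {Z : Chain (i + m)} → (∀ s → X s ≡ true → Z (up i s) ≡ true) → upᶜ i X ⊑ Z
upᶜ-⊑ zero    p s e = p s e
upᶜ-⊑ (suc i) {Z = Z} p (outside ∷ s) e = upᶜ-⊑ i {Z = deletion Z} p s e

upᶜ-cong : ∀ i {X Y : Chain m} → X ≈ Y → upᶜ i X ≈ upᶜ i Y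
upᶜ-cong zero    e s             = e s
upᶜ-cong (suc i) e (outside ∷ s) = upᶜ-cong i e s
upᶜ-cong (suc i) e (inside  ∷ s) = refl

upᶜ-𝟘 : ∀ i → upᶜ i (𝟘 {m}) ≈ 𝟘
upᶜ-𝟘 zero    s             = refl
upᶜ-𝟘 (suc i) (outside ∷ s) = upᶜ-𝟘 i s
upᶜ-𝟘 (suc i) (inside  ∷ s) = refl

upᶜ-⊕ : ∀ i (X Y : Chain m) → upᶜ i (X ⊕ Y) ≈ (upᶜ i X ⊕ upᶜ i Y)
upᶜ-⊕ zero    X Y s             = refl
upᶜ-⊕ (suc i) X Y (outside ∷ s) = upᶜ-⊕ i X Y s
upᶜ-⊕ (suc i) X Y (inside  ∷ s) = refl

upᶜ-· : ∀ i b (X : Chain m) → upᶜ i (b · X) ≈ (b · upᶜ i X)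
upᶜ-· zero    b X s             = refl
upᶜ-· (suc i) b X (outside ∷ s) = upᶜ-· i b X s
upᶜ-· (suc i) b X (inside  ∷ s) = sym (∧-zeroʳ b)

upᶜ-δ : ∀ i (σ : Subset m) → δ (up i σ) ≈ upᶜ i (δ σ)
upᶜ-δ zero    σ s             = refl
upᶜ-δ (suc i) σ (outside ∷ s) = upᶜ-δ i σ s
upᶜ-δ (suc i) σ (inside  ∷ s) = refl

bd-upᶜ : ∀ i (X : Chain m) → bd (upᶜ i X) ≈ upᶜ i (bd X)
bd-upᶜ zero    X s             = refl
bd-upᶜ (suc i) X (outside ∷ s) = trans (xor-identityʳ _) (bd-upᶜ i X s)
bd-upᶜ (suc i) X (inside  ∷ s) = bd-𝟘 s

bd-δ-up : ∀ i (σ : Subset m) → bd (δ (up i σ)) ≈ upᶜ i (bd (δ σ))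
bd-δ-up i σ = ≈-trans (bd-cong (upᶜ-δ i σ)) (bd-upᶜ i (δ σ))

upᶜ-cycle : ∀ i {z : Chain m} → Cycle z → Cycle (upᶜ i z)
upᶜ-cycle i {z} c = ≈-trans (bd-upᶜ i z) (≈-trans (upᶜ-cong i c) (upᶜ-𝟘 i))

upᶜ-uniform : ∀ i {X : Chain m} → Uniform k X → Uniform k (upᶜ i X)
upᶜ-uniform zero    p s             e = p s e
upᶜ-uniform (suc i) p (outside ∷ s) e = upᶜ-uniform i p s e

upᶜ-below : ∀ i {X : Chain m} → Below k X → Below k (upᶜ i X)
upᶜ-below zero    p s             e = p s e
upᶜ-below (suc i) p (outside ∷ s) e = upᶜ-below i p s e

∑-up : ∀ i k (f : Subset (i + m) → ℕ) → ∑ k (λ s → f (up i s)) ≤ ∑ k f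
∑-up zero    k       f = ≤-refl
∑-up (suc i) zero    f = ∑-up i 0 (f ∘ (outside ∷_))
∑-up (suc i) (suc k) f = ≤-trans (∑-up i (suc k) (f ∘ (outside ∷_))) (m≤m+n _ _)

vol-upᶜ : ∀ i k (X : Chain m) → vol k X ≤ vol k (upᶜ i X)
vol-upᶜ i k X = ≤-trans (≤-reflexive (∑-cong k (λ s _ → cong ι (sym (upᶜ-up i X s))))) (∑-up i k (ι ∘ upᶜ i X))

Contains : ∀ i → Tree m k → Tree (i + m) k → Set
Contains i T T′ = ∀ s → has T s ≡ true → has T′ (up i s) ≡ true

module _ (i : ℕ) (T : Tree m k) (T′ : Tree (i + m) k) (T⊆T′ : Contains i T T′) where

  -- The filling in the smaller tree, embedded, is still a filling inside the larger one, and
  -- fillings are unique.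
  fill-up : ∀ {z} → Below k z → Cycle z → fill T′ (upᶜ i z) ≈ upᶜ i (fill T z)
  fill-up {z} b c = ≈-sym (fill-unique T′ (upᶜ-below i b) (upᶜ-cycle i c)
    (upᶜ-⊑ i {Z = has T′} (λ s e → T⊆T′ s (fill⊑ T b c s e)))
    (≈-trans (bd-upᶜ i (fill T z)) (upᶜ-cong i (bd-fill T b c))))

  fillσ-up : ∀ σ → ∣ σ ∣ ≡ k → fillσ T′ (up i σ) ≈ upᶜ i (fillσ T σ)
  fillσ-up σ p = ≈-trans
    (fill-cong T′ (σ-below T′ (up i σ) (trans (card-up i σ) p)) (bd-bd (δ (up i σ))) (bd-δ-up i σ))
    (fill-up (σ-below T σ p) (bd-bd (δ σ)))

-- This supplies a placeholder link. For `i = 0` it is `T` itself, since `someTree` asks for a top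
-- vertex.
treeUp : ∀ i → Tree n k → Tree (i + n) k
treeUp zero    T = T
treeUp (suc i) T = someTree _ _

-- Subdivision of a simplex

-- The star of the top vertex of `α` contains every facet of `α` except `ζ`, the one opposite to
-- that vertex. The vertices above are then added with arbitrary links.
facetTree : (α : Subset n) → ∣ α ∣ ≡ suc (suc k) → Σ (Tree n (suc k)) λ P → Σ (Subset n) λ ζ →
  bd (δ α) ζ ≡ true × has P ζ ≡ false × (∀ s → bd (δ α) s ≡ true → s ≢ ζ → has P s ≡ true)
facetTree {suc n} {k} (inside ∷ α) p = P , (outside ∷ α) ,
  trans (cong (_xor δ α α) (bd-𝟘 α)) (δ-refl α) , refl , facets
  where
  P = star n k
  facets : ∀ s → bd (δ (inside ∷ α)) s ≡ true → s ≢ outside ∷ α → has P s ≡ true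
  facets (outside ∷ s) e q =
    contradiction (cong (outside ∷_) (δ⇒≡ α s (trans (cong (_xor δ α s) (sym (bd-𝟘 s))) e))) q
  facets (inside  ∷ s) e q with ∣ s ∣ ≟ k
  ... | yes _ = refl
  ... | no ¬r = contradiction (suc-injective (trans (bd-below (δ-uniform α refl) s e) (suc-injective p))) ¬r
facetTree {suc zero} (outside ∷ []) ()
facetTree {suc (suc n)} {k} (outside ∷ α) p with facetTree α p
... | P , ζ , ∂ζ , Pζ , facets =
  extend P (someTree n k) , (outside ∷ ζ) , trans (xor-identityʳ _) ∂ζ , Pζ ,
  λ { (outside ∷ s) e q → facets s (trans (sym (xor-identityʳ _)) e) (λ r → q (cong (outside ∷_) r))
    ; (inside ∷ s) e q → ⊥-elim (false≢true (bd-𝟘 s) e) }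

module Subdivide (Q : Tree n (suc (suc k))) (α : Subset n) (Qα : has Q α ≡ true) where

  private
    facet = facetTree α (uniform Q α Qα)
    P = proj₁ facet
    ζ = proj₁ (proj₂ facet)
    ∂ζ = proj₁ (proj₂ (proj₂ facet))
    Pζ = proj₁ (proj₂ (proj₂ (proj₂ facet)))
    facets = proj₂ (proj₂ (proj₂ (proj₂ facet)))

  cone : Tree (suc n) (suc (suc k))
  cone = extend Q P

  ∂cone : Chain (suc n)
  ∂cone = bd (δ (inside ∷ α))

  deletion-∂cone : deletion ∂cone ≈ δ α
  deletion-∂cone s = cong (_xor δ α s) (bd-𝟘 s)

  -- The boundary of u * α, for the new vertex u, consists of α and u * ∂α. All of it lies in `cone`
  -- except u * ζ, because `P` contains the other facets of `α`. Exchanging α for u * ζ thus leaves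
  -- u * ∂α in place of α.
  tree : Tree (suc n) (suc (suc k))
  tree = exchange cone {∂cone} {outside ∷ α} {inside ∷ ζ} (bd-bd (δ (inside ∷ α))) ⊑cone
    (trans (deletion-∂cone α) (δ-refl α)) ∂ζ Qα Pζ
    (trans (bd-below (δ-uniform α refl) ζ ∂ζ) (uniform Q α Qα))
    where
    ⊑cone : ∀ s → ∂cone s ≡ true → s ≢ inside ∷ ζ → has cone s ≡ true
    ⊑cone (outside ∷ s) e q = trans (cong (has Q) (δ⇒≡ α s (trans (sym (deletion-∂cone s)) e))) Qα
    ⊑cone (inside  ∷ s) e q = facets s e (λ r → q (cong (inside ∷_) r))

  has-old : ∀ s → s ≢ α → has tree (outside ∷ s) ≡ has Q s
  has-old s p = trans (xor-identityʳ _) (trans (cong (has Q s xor_) (δ≡false α s p)) (xor-identityʳ _))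

  -- `cone` fills an old simplex as `Q` does, and the exchange reroutes this filling through `∂cone`
  -- exactly when it uses `α`.
  fill-old : ∀ σ → ∣ σ ∣ ≡ suc (suc k) →
             fillσ tree (outside ∷ σ) ≈ (⟨ fillσ Q σ , 𝟘 ⟩ ⊕ fillσ Q σ α · ∂cone)
  fill-old σ p s = cong₂ (λ b c → b xor (c ∧ ∂cone s)) (cone-fill s) (cone-fill (outside ∷ α))
    where
    cone-fill : fillσ cone (outside ∷ σ) ≈ ⟨ fillσ Q σ , 𝟘 ⟩
    cone-fill = fillσ-up 1 Q cone (λ _ e → e) σ p

-- Subdivision of many simplices

up-injective : ∀ i {s t : Subset m} → up i s ≡ up i t → s ≡ t
up-injective zero    e = e
up-injective (suc i) e = up-injective i (∷-injectiveʳ e)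

module Subdivisions {m k : ℕ} (G H : Tree (suc m) (suc (suc k))) where

  private
    M = suc m
    κ = suc (suc k)

  gain : Subset M → ℕ
  gain α = vol κ (fillσ H α)

  weight : List (Subset M) → Subset M → ℕ
  weight αs τ = ∑ᴸ αs (λ α → ι (fillσ G τ α) * gain α)

  -- Q arises from G by subdividing every α ∈ αs with a new vertex u, and u * H ⊆ R.  Since
  -- u * ∂α occurs in Fill(τ, Q) whenever α ∈ Fill(τ, G), the filling in R of τ + Fill(τ, Q)
  -- contains u * Fill(α, H).
  record Stage (αs : List (Subset M)) : Set where
    private
      i = length αs
    field
      R        : Tree (i + M) (suc κ)
      E Q      : Tree (i + M) κ
      H⊆E      : Contains i H E
      has-old  : ∀ s → All (s ≢_) αs → has Q (up i s) ≡ has G s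
      fill-old : ∀ τ → ∣ τ ∣ ≡ κ → ∀ s → All (s ≢_) αs → fillσ Q (up i τ) (up i s) ≡ fillσ G τ s
      -- The cycle y absorbs the contributions of the later vertices.
      gained   : ∀ τ → ∣ τ ∣ ≡ κ → ∀ y → Uniform κ y → Cycle y →
                 weight αs τ ≤ vol (suc κ) (fill R (δ (up i τ) ⊕ fillσ Q (up i τ) ⊕ upᶜ i y))

  open Stage

  -- The filling in the new `R` splits at the new top vertex u. Its link is Fill(α, H) if α ∈
  -- Fill(τ, G) and empty otherwise, which accounts for the new summand of the weight. What is left
  -- for the old `R` has again the form required in `gained`, with another cycle in place of `y`.
  subdivide : ∀ {α αs} → has G α ≡ true → All (α ≢_) αs → Stage αs → Stage (α ∷ αs)
  subdivide {α} {αs} Gα fresh S = record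
    { R        = extend (R S) (E S)
    ; E        = extend (E S) (treeUp i (star m k))
    ; Q        = tree
    ; H⊆E      = H⊆E S
    ; has-old  = λ { s (s≢α ∷ p) → trans (Sub.has-old (up i s) (s≢α ∘ up-injective i)) (has-old S s p) }
    ; fill-old = λ { τ q s (s≢α ∷ p) →
        trans (Sub.fill-old (up i τ) (trans (card-up i τ) q) (outside ∷ up i s))
        (trans (cong (λ b → fillσ (Q S) (up i τ) (up i s) xor (fillσ (Q S) (up i τ) (up i α) ∧ b))
                     (trans (Sub.deletion-∂cone (up i s)) (δ≡false (up i α) (up i s) (s≢α ∘ up-injective i))))
        (trans (cong (fillσ (Q S) (up i τ) (up i s) xor_) (∧-zeroʳ _))
        (trans (xor-identityʳ _) (fill-old S τ q s p)))) }
    ; gained   = gained⁺ }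
    where
    i = length αs
    module Sub = Subdivide (Q S) (up i α) (trans (has-old S α fresh) Gα)
    open Sub using (tree)
    cardα : ∣ α ∣ ≡ κ
    cardα = uniform G α Gα
    gained⁺ : ∀ τ → ∣ τ ∣ ≡ κ → ∀ y → Uniform κ y → Cycle y → weight (α ∷ αs) τ ≤
      vol (suc κ) (fill (extend (R S) (E S)) (δ (up (suc i) τ) ⊕ fillσ tree (up (suc i) τ) ⊕ upᶜ (suc i) y))
    gained⁺ τ q y uy cy = ≤-trans (≤-reflexive (+-comm _ (weight αs τ))) (+-mono-≤ older newest)
      where
      σ = up i τ
      cardσ : ∣ σ ∣ ≡ κ
      cardσ = trans (card-up i τ) q
      z = δ (up (suc i) τ) ⊕ fillσ tree (up (suc i) τ) ⊕ upᶜ (suc i) y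
      c = fillσ (Q S) σ (up i α)
      c≡ : c ≡ fillσ G τ α
      c≡ = fill-old S τ q α fresh
      -- Up to the embedding this is the link of `z` at the new vertex: `∂α` if the filling of `τ`
      -- was rerouted, zero otherwise.
      w = c · bd (δ α)
      w-below : Below κ w
      w-below s e = σ-below H α cardα s (proj₂ (∧-true {c} e))
      w-cycle : Cycle w
      w-cycle = ·-cycle c (bd-bd (δ α))
      link-z : link z ≈ upᶜ i w
      link-z t = trans (xor-identityʳ _)
        (trans (Sub.fill-old σ cardσ (inside ∷ t))
        (trans (cong (c ∧_) (bd-δ-up i α t)) (sym (upᶜ-· i c (bd (δ α)) t))))
      fill-link : fill (E S) (link z) ≈ upᶜ i (fill H w)
      fill-link = ≈-trans
        (≈-sym (fill-cong (E S) (upᶜ-below i w-below) (upᶜ-cycle i w-cycle) (≈-sym link-z)))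
        (fill-up i H (E S) (H⊆E S) w-below w-cycle)
      gain≤ : ∀ b → ι b * gain α ≤ vol κ (fill H (b · bd (δ α)))
      gain≤ false = z≤n
      gain≤ true  = ≤-reflexive (+-identityʳ _)
      newest : ι (fillσ G τ α) * gain α ≤ vol κ (fill (E S) (link z))
      newest = begin
        ι (fillσ G τ α) * gain α     ≡⟨ cong (λ b → ι b * gain α) c≡ ⟨
        ι c * gain α                 ≤⟨ gain≤ c ⟩
        vol κ (fill H w)             ≤⟨ vol-upᶜ i κ (fill H w) ⟩
        vol κ (upᶜ i (fill H w))     ≡⟨ vol-cong κ fill-link ⟨
        vol κ (fill (E S) (link z))  ∎
        where open ≤-Reasoning
      -- The term `c · δ α` comes from the rerouting through `∂cone`, the term `fill H w` from
      -- filling the link. Together they form a cycle on the first vertices, and so are absorbed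
      -- into `y`.
      y′ = y ⊕ (c · δ α ⊕ fill H w)
      y′-uniform : Uniform κ y′
      y′-uniform = ⊕-uniform uy (⊕-uniform (·-uniform c (δ-uniform α cardα)) (fill-uniform H w-below w-cycle))
      y′-cycle : Cycle y′
      y′-cycle = ⊕-cycle cy (≈-trans (bd-⊕ (c · δ α) (fill H w))
        (≈⇒⊕≈𝟘 (≈-trans (bd-· c (δ α)) (≈-sym (bd-fill H w-below w-cycle)))))
      z′ = δ σ ⊕ fillσ (Q S) σ ⊕ upᶜ i y′
      rest≈ : (deletion z ⊕ fill (E S) (link z)) ≈ z′
      rest≈ t = begin
        ((δ σ t xor fillσ tree (outside ∷ σ) (outside ∷ t)) xor upᶜ i y t) xor fill (E S) (link z) t
          ≡⟨ cong₂ (λ a b → ((δ σ t xor a) xor upᶜ i y t) xor b) fill-tree (fill-link t) ⟩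
        ((δ σ t xor (fillσ (Q S) σ t xor upᶜ i (c · δ α) t)) xor upᶜ i y t) xor upᶜ i (fill H w) t
          ≡⟨ rearrange (δ σ t) _ _ _ _ ⟩
        (δ σ t xor fillσ (Q S) σ t) xor (upᶜ i y t xor (upᶜ i (c · δ α) t xor upᶜ i (fill H w) t))
          ≡⟨ cong (λ b → (δ σ t xor fillσ (Q S) σ t) xor (upᶜ i y t xor b)) (upᶜ-⊕ i (c · δ α) (fill H w) t) ⟨
        (δ σ t xor fillσ (Q S) σ t) xor (upᶜ i y t xor upᶜ i (c · δ α ⊕ fill H w) t)
          ≡⟨ cong ((δ σ t xor fillσ (Q S) σ t) xor_) (upᶜ-⊕ i y _ t) ⟨
        z′ t ∎
        where
        open ≡-Reasoning
        fill-tree : fillσ tree (outside ∷ σ) (outside ∷ t) ≡ fillσ (Q S) σ t xor upᶜ i (c · δ α) t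
        fill-tree = trans (Sub.fill-old σ cardσ (outside ∷ t)) (cong (fillσ (Q S) σ t xor_)
          (trans (cong (c ∧_) (trans (Sub.deletion-∂cone t) (upᶜ-δ i α t))) (sym (upᶜ-· i c (δ α) t))))
        rearrange : ∀ a b d e f → ((a xor (b xor d)) xor e) xor f ≡ (a xor b) xor (e xor (d xor f))
        rearrange = solve 5 (λ a b d e f → ((a :+ (b :+ d)) :+ e) :+ f := (a :+ b) :+ (e :+ (d :+ f))) refl
      older : weight αs τ ≤ vol (suc κ) (fill (R S) (deletion z ⊕ fill (E S) (link z)))
      older = ≤-trans (gained S τ q y′ y′-uniform y′-cycle) (≤-reflexive (vol-cong (suc κ)
        (fill-cong (R S)
          (uniform-below (⊕-uniform (fundamental-uniform (Q S) σ cardσ) (upᶜ-uniform i y′-uniform)))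
          (⊕-cycle (fundamental-cycle (Q S) σ cardσ) (upᶜ-cycle i y′-cycle))
          (≈-sym rest≈))))

  stage : ∀ αs → All (λ α → has G α ≡ true) αs → Unique αs → Stage αs
  stage []       _        _              = record
    { R = star m κ ; E = H ; Q = G ; H⊆E = λ _ e → e ; has-old = λ _ _ → refl
    ; fill-old = λ _ _ _ _ → refl ; gained = λ _ _ _ _ _ → z≤n }
  stage (α ∷ αs) (Gα ∷ G∋) (fresh ∷ uniq) = subdivide Gα fresh (stage αs G∋ uniq)

-- Total filling volume under added vertices

mixed : Tree n (suc k) → Tree n k → ℕ
mixed {k = k} R Q = ∑ k (λ τ → vol (suc k) (fill R (δ τ ⊕ fillσ Q τ)))

-- Old simplices keep their fillings. For the new vertex x, the filling of x * τ consists of x *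
-- Fill(τ, S) and of the filling in `T` of the cycle τ + Fill(τ, S); the latter parts add up to
-- `mixed T S`.
total-extend : (T : Tree n (suc k)) (S : Tree n k) → total T + (mixed T S + total S) ≤ total (extend T S)
total-extend {n} {k} T S = +-mono-≤ old (≤-trans (≤-reflexive (sym (∑-+ {n} k _ _))) (∑-mono k new))
  where
  T⁺ = extend T S
  old : total T ≤ ∑ (suc k) (λ σ → vol (suc k) (fillσ T⁺ (outside ∷ σ)))
  old = ∑-mono (suc k) λ σ q → ≤-trans (vol-upᶜ 1 (suc k) (fillσ T σ))
    (≤-reflexive (vol-cong (suc k) (≈-sym (fillσ-up 1 T T⁺ (λ _ e → e) σ q))))
  new : ∀ τ → ∣ τ ∣ ≡ k →
        vol (suc k) (fill T (δ τ ⊕ fillσ S τ)) + vol k (fillσ S τ) ≤ vol (suc k) (fillσ T⁺ (inside ∷ τ))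
  new τ q = +-monoˡ-≤ _ (≤-reflexive (vol-cong (suc k)
    (fill-cong T (uniform-below (fundamental-uniform S τ q)) (fundamental-cycle S τ q)
      (λ t → cong (λ b → (b xor δ τ t) xor fillσ S τ t) (sym (bd-𝟘 t))))))

mixed-up : ∀ j (R : Tree n (suc k)) (Q : Tree n k) (T : Tree (j + n) (suc k)) (S : Tree (j + n) k) →
           Contains j R T → Contains j Q S → mixed R Q ≤ mixed T S
mixed-up {k = k} j R Q T S R⊆T Q⊆S = ≤-trans (∑-mono k step) (∑-up j k _)
  where
  open ≤-Reasoning
  step : ∀ τ → ∣ τ ∣ ≡ k →
         vol (suc k) (fill R (δ τ ⊕ fillσ Q τ)) ≤ vol (suc k) (fill T (δ (up j τ) ⊕ fillσ S (up j τ)))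
  step τ q = begin
    vol (suc k) (fill R z)          ≤⟨ vol-upᶜ j (suc k) (fill R z) ⟩
    vol (suc k) (upᶜ j (fill R z))  ≡⟨ vol-cong (suc k) (fill-up j R T R⊆T z-below z-cycle) ⟨
    vol (suc k) (fill T (upᶜ j z))
      ≡⟨ vol-cong (suc k) (fill-cong T (upᶜ-below j z-below) (upᶜ-cycle j z-cycle) rest≈) ⟩
    vol (suc k) (fill T (δ (up j τ) ⊕ fillσ S (up j τ))) ∎
    where
    z = δ τ ⊕ fillσ Q τ
    z-below : Below (suc k) z
    z-below = uniform-below (fundamental-uniform Q τ q)
    z-cycle : Cycle z
    z-cycle = fundamental-cycle Q τ q
    rest≈ : upᶜ j z ≈ (δ (up j τ) ⊕ fillσ S (up j τ))
    rest≈ t = trans (upᶜ-⊕ j (δ τ) (fillσ Q τ) t)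
      (cong₂ _xor_ (sym (upᶜ-δ j τ t)) (sym (fillσ-up j Q S Q⊆S τ q t)))

-- Vertices are stacked one by one. The tree below each contains `R` and its link contains `Q`, so
-- each adds at least `mixed R Q` to the total. `P` starts the placeholder links by which the links
-- `S` themselves grow.
module Tower {p k : ℕ} (R : Tree p (suc (suc k))) (Q : Tree p (suc k)) (P : Tree p k) where

  record Floor (j : ℕ) : Set where
    field
      T     : Tree (j + p) (suc (suc k))
      S     : Tree (j + p) (suc k)
      R⊆T   : Contains j R T
      Q⊆S   : Contains j Q S
      large : j * mixed R Q ≤ total T

  open Floor

  floor : ∀ j → Floor j
  floor zero    = record { T = R ; S = Q ; R⊆T = λ _ e → e ; Q⊆S = λ _ e → e ; large = z≤n }
  floor (suc j) = record
    { T = extend (T F) (S F) ; S = extend (S F) (treeUp j P) ; R⊆T = R⊆T F ; Q⊆S = Q⊆S F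
    ; large = ≤-trans (≤-reflexive (+-comm (mixed R Q) _))
        (≤-trans (+-mono-≤ (large F) (≤-trans (mixed-up j R Q (T F) (S F) (R⊆T F) (Q⊆S F)) (m≤m+n _ _)))
                 (total-extend (T F) (S F))) }
    where
    F = floor j

-- The trivial lower bound

facet-exists : (σ : Subset n) → ∣ σ ∣ ≡ suc k → ∃ λ t → bd (δ σ) t ≡ true
facet-exists (inside  ∷ σ) p = outside ∷ σ , trans (cong (_xor δ σ σ) (bd-𝟘 σ)) (δ-refl σ)
facet-exists (outside ∷ σ) p with facet-exists σ p
... | t , e = outside ∷ t , trans (xor-identityʳ _) e
facet-exists [] ()

vol≡0 : {X : Chain n} → Uniform k X → vol k X ≡ 0 → X ≈ 𝟘
vol≡0 {k = k} {X} u e s = ¬-not λ q → 1≰0 q (u s q)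
  where
  1≰0 : X s ≡ true → ∣ s ∣ ≡ k → ⊥
  1≰0 q refl = case ≤-trans (≤-reflexive (sym (vol-δ s))) (≤-trans (∑-mono k below) (≤-reflexive e)) of λ ()
    where
    below : ∀ t → ∣ t ∣ ≡ k → ι (δ s t) ≤ ι (X t)
    below t _ with δ s t in d
    ... | false = z≤n
    ... | true  rewrite δ⇒≡ s t d | q = ≤-refl

-- An empty filling would have zero boundary, whereas `σ` has a facet.
fillσ-nonempty : (T : Tree n (suc k)) (σ : Subset n) → ∣ σ ∣ ≡ suc k → 1 ≤ vol (suc k) (fillσ T σ)
fillσ-nonempty {k = k} T σ p with vol (suc k) (fillσ T σ) in e
... | suc _ = s≤s z≤n
... | zero with facet-exists σ p
... | t , q = ⊥-elim (false≢true
  (trans (sym (bd-fillσ T σ p t)) (trans (bd-cong (vol≡0 (fillσ-uniform T σ p) e) t) (bd-𝟘 t))) q)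

total-trivial : (T : Tree n (suc k)) → n C suc k ≤ total T
total-trivial {n} {k} T = ≤-trans (≤-reflexive (sym (∑-one {n} (suc k)))) (∑-mono (suc k) (fillσ-nonempty T))

-- Paths

-- `star n 0` consists of the last vertex alone, so each new vertex is joined to its predecessor.
path : ∀ n → Tree (suc n) 2
path zero    = star 0 1
path (suc n) = extend (path n) (star n 0)

-- `mixed (path n) (star n 0)` is the sum of the distances of all vertices from the last one. Each
-- of the `suc n` old vertices is one edge farther from the next vertex; `total S` counts these
-- extra edges.
firstDistances : ∀ n → suc n + mixed (path n) (star n 0) ≤ mixed (path (suc n)) (star (suc n) 0)
firstDistances n = begin
  suc n + mixed (path n) S
    ≤⟨ +-monoˡ-≤ _ (≤-trans (≤-reflexive (sym (nC1≡n (suc n)))) (total-trivial S)) ⟩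
  total S + mixed (path n) S                      ≡⟨ +-comm (total S) _ ⟩
  mixed (path n) S + total S
    ≡⟨ ∑-+ 1 (λ τ → vol 2 (fill (path n) (δ τ ⊕ fillσ S τ))) (λ τ → vol 1 (fillσ S τ)) ⟨
  ∑ 1 (λ τ → vol 2 (fill (path n) (δ τ ⊕ fillσ S τ)) + vol 1 (fillσ S τ)) ≤⟨ ∑-mono {suc n} 1 step ⟩
  ∑ 1 (λ τ → vol 2 (fill (path (suc n)) (δ (up 1 τ) ⊕ fillσ S⁺ (up 1 τ))))
    ≤⟨ ∑-up 1 1 (λ τ → vol 2 (fill (path (suc n)) (δ τ ⊕ fillσ S⁺ τ))) ⟩
  mixed (path (suc n)) S⁺                         ∎
  where
  open ≤-Reasoning
  S = star n 0
  S⁺ = star (suc n) 0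
  step : ∀ τ → ∣ τ ∣ ≡ 1 → vol 2 (fill (path n) (δ τ ⊕ fillσ S τ)) + vol 1 (fillσ S τ) ≤
                           vol 2 (fill (path (suc n)) (δ (up 1 τ) ⊕ fillσ S⁺ (up 1 τ)))
  step τ p = ≤-reflexive (cong₂ _+_
    (vol-cong 2 (fill-cong (path n) (uniform-below (fundamental-uniform S τ p)) (fundamental-cycle S τ p)
      (λ t → cong₂ _xor_ (sym (xor-identityʳ (δ τ t))) (fill-link t))))
    (vol-cong 1 fill-link))
    where
    fill-link : fillσ S τ ≈ fill S (link (δ (up 1 τ) ⊕ fillσ S⁺ (up 1 τ)))
    fill-link = fill-cong S (σ-below S τ p) (bd-bd (δ τ)) (λ t → sym (xor-identityʳ _))

firstDistances-sum : ∀ n → n * suc n ≤ 2 * mixed (path n) (star n 0)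
firstDistances-sum zero    = z≤n
firstDistances-sum (suc n) = begin
  suc n * suc (suc n)       ≡⟨ identity n ⟩
  2 * suc n + n * suc n     ≤⟨ +-monoʳ-≤ (2 * suc n) (firstDistances-sum n) ⟩
  2 * suc n + 2 * D         ≡⟨ *-distribˡ-+ 2 (suc n) D ⟨
  2 * (suc n + D)           ≤⟨ *-monoʳ-≤ 2 (firstDistances n) ⟩
  2 * mixed (path (suc n)) (star (suc n) 0) ∎
  where
  open ≤-Reasoning
  D = mixed (path n) (star n 0)
  identity : ∀ n → suc n * suc (suc n) ≡ 2 * suc n + n * suc n
  identity = solve-∀

-- The distances between the vertices of the path sum to C(n + 2, 3). The induction adds the
-- distances from the new vertex, which are those from its predecessor plus one edge each.
path-total : ∀ n → n * suc n * suc (suc n) ≤ 6 * total (path n)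
path-total zero    = z≤n
path-total (suc n) = begin
  suc n * suc (suc n) * suc (suc (suc n))    ≡⟨ identity n ⟩
  n * suc n * suc (suc n) + (3 * (n * suc n) + 6 * suc n)
    ≤⟨ +-mono-≤ (path-total n) (+-monoˡ-≤ (6 * suc n) (*-monoʳ-≤ 3 (firstDistances-sum n))) ⟩
  6 * total (path n) + (3 * (2 * D) + 6 * suc n) ≡⟨ collect (total (path n)) D (suc n) ⟩
  6 * (total (path n) + (D + suc n))
    ≤⟨ *-monoʳ-≤ 6 (+-monoʳ-≤ (total (path n)) (+-monoʳ-≤ D
         (≤-trans (≤-reflexive (sym (nC1≡n (suc n)))) (total-trivial (star n 0))))) ⟩
  6 * (total (path n) + (D + total (star n 0))) ≤⟨ *-monoʳ-≤ 6 (total-extend (path n) (star n 0)) ⟩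
  6 * total (path (suc n)) ∎
  where
  open ≤-Reasoning
  D = mixed (path n) (star n 0)
  identity : ∀ n → suc n * suc (suc n) * suc (suc (suc n)) ≡ n * suc n * suc (suc n) + (3 * (n * suc n) + 6 * suc n)
  identity = solve-∀
  collect : ∀ t d s → 6 * t + (3 * (2 * d) + 6 * s) ≡ 6 * (t + (d + s))
  collect = solve-∀

-- Listing the simplices and selecting the best

elements : ℕ → Chain n → List (Subset n)
elements {zero}  zero    X = if X [] then [] ∷ [] else []
elements {zero}  (suc k) X = []
elements {suc n} zero    X = map (outside ∷_) (elements 0 (deletion X))
elements {suc n} (suc k) X =
  map (outside ∷_) (elements (suc k) (deletion X)) ++ map (inside ∷_) (elements k (link X))

∑ᴸ-elements : ∀ k (X : Chain n) (g : Subset n → ℕ) → ∑ᴸ (elements k X) g ≡ ∑ k (λ s → ι (X s) * g s)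
∑ᴸ-elements {zero}  zero    X g with X []
... | true  = refl
... | false = refl
∑ᴸ-elements {zero}  (suc k) X g = refl
∑ᴸ-elements {suc n} zero    X g =
  trans (∑ᴸ-map (outside ∷_) (elements 0 (deletion X)) g) (∑ᴸ-elements 0 (deletion X) (g ∘ (outside ∷_)))
∑ᴸ-elements {suc n} (suc k) X g = trans (∑ᴸ-++ (map (outside ∷_) (elements (suc k) (deletion X))) _ g) (cong₂ _+_
  (trans (∑ᴸ-map (outside ∷_) (elements (suc k) (deletion X)) g)
         (∑ᴸ-elements (suc k) (deletion X) (g ∘ (outside ∷_))))
  (trans (∑ᴸ-map (inside ∷_) (elements k (link X)) g) (∑ᴸ-elements k (link X) (g ∘ (inside ∷_)))))

length-elements : ∀ k (X : Chain n) → length (elements k X) ≡ vol k X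
length-elements k X = trans (sym (trans (∑ᴸ-const (elements k X) 1) (*-identityʳ _)))
  (trans (∑ᴸ-elements k X (λ _ → 1)) (∑-cong k (λ s _ → *-identityʳ (ι (X s)))))

elements-∈ : ∀ k (X : Chain n) → All (λ s → X s ≡ true) (elements k X)
elements-∈ {zero}  zero    X with X [] in e
... | true  = e ∷ []
... | false = []
elements-∈ {zero}  (suc k) X = []
elements-∈ {suc n} zero    X = All-map⁺ (elements-∈ 0 (deletion X))
elements-∈ {suc n} (suc k) X =
  All-++⁺ (All-map⁺ (elements-∈ (suc k) (deletion X))) (All-map⁺ (elements-∈ k (link X)))

elements-unique : ∀ k (X : Chain n) → Unique (elements k X)
elements-unique {zero}  zero    X with X []
... | true  = [] ∷ []
... | false = []
elements-unique {zero}  (suc k) X = []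
elements-unique {suc n} zero    X = Unique.map⁺ ∷-injectiveʳ (elements-unique 0 (deletion X))
elements-unique {suc n} (suc k) X = AllPairs.++⁺
  (Unique.map⁺ ∷-injectiveʳ (elements-unique (suc k) (deletion X)))
  (Unique.map⁺ ∷-injectiveʳ (elements-unique k (link X)))
  (All-map⁺ (universal (λ _ → All-map⁺ (universal (λ _ ()) _)) _))

Unique-resp-⊆ : {xs ys : List I} → xs ⊆ ys → Unique ys → Unique xs
Unique-resp-⊆ []         []       = []
Unique-resp-⊆ (_ ∷ʳ p)   (_ ∷ u)  = Unique-resp-⊆ p u
Unique-resp-⊆ (refl ∷ p) (a ∷ u)  = All-resp-⊆ p a ∷ Unique-resp-⊆ p u

module _ (g : I → ℕ) where

  -- Minimality of the removed value is recorded in the last component in averaged form, as the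
  -- selection uses it: the value does not exceed the average of the remaining ones.
  removeMin : ∀ x xs → ∃ λ ys → ∃ λ y → ys ⊆ x ∷ xs × length ys ≡ length xs ×
              ∑ᴸ (x ∷ xs) g ≡ g y + ∑ᴸ ys g × length ys * g y ≤ ∑ᴸ ys g
  removeMin x [] = [] , x , (x ∷ʳ []) , refl , refl , z≤n
  removeMin x (x′ ∷ xs) with removeMin x′ xs
  ... | ys , y , sub , len , eq , le with ≤-total (g x) (g y)
  ... | inj₁ gx≤gy = x′ ∷ xs , x , (x ∷ʳ ⊆-refl) , refl , refl ,
    ≤-trans (*-monoʳ-≤ (suc (length xs)) gx≤gy)
    (≤-trans (≤-reflexive (cong (λ l → g y + l * g y) (sym len)))
    (≤-trans (+-monoʳ-≤ (g y) le) (≤-reflexive (sym eq))))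
  ... | inj₂ gy≤gx = x ∷ ys , y , (refl ∷ sub) , cong suc len ,
    trans (cong (g x +_) eq) (trans (sym (+-assoc (g x) (g y) _))
      (trans (cong (_+ ∑ᴸ ys g) (+-comm (g x) (g y))) (+-assoc (g y) (g x) _))) ,
    +-mono-≤ gy≤gx le

  -- Removing a least entry never lowers the average. After `d` removals `r` entries remain, and
  -- their average is at least the original one.
  selectBest : ∀ r d xs → length xs ≡ d + r →
    ∃ λ ys → ys ⊆ xs × length ys ≡ r × r * ∑ᴸ xs g ≤ length xs * ∑ᴸ ys g
  selectBest r zero    xs       e = xs , ⊆-refl , e , ≤-reflexive (cong (_* ∑ᴸ xs g) (sym e))
  selectBest r (suc d) (x ∷ xs) e with removeMin x xs
  ... | ys , y , sub , len , eq , le with selectBest r d ys (trans len (suc-injective e))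
  ... | zs , sub′ , len′ , le′ = zs , ⊆-trans sub′ sub , len′ , bound (length ys) refl
    where
    open ≤-Reasoning
    bound : ∀ l → length ys ≡ l → r * ∑ᴸ (x ∷ xs) g ≤ suc (length xs) * ∑ᴸ zs g
    -- Here `d + r = 0`, hence `r = 0`; this case is apart because the other cancels the length of
    -- `ys`.
    bound zero    l≡0 = subst (λ t → t * ∑ᴸ (x ∷ xs) g ≤ suc (length xs) * ∑ᴸ zs g)
      (sym (m+n≡0⇒n≡0 d (trans (sym (suc-injective e)) (trans (sym len) l≡0)))) z≤n
    bound (suc l) l≡ = *-cancelˡ-≤ (suc l) (begin
      suc l * (r * ∑ᴸ (x ∷ xs) g)            ≡⟨ cong (λ t → suc l * (r * t)) eq ⟩
      suc l * (r * (g y + ∑ᴸ ys g))          ≡⟨ expand (suc l) r (g y) (∑ᴸ ys g) ⟩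
      r * (suc l * g y) + r * (suc l * ∑ᴸ ys g)
        ≤⟨ +-monoˡ-≤ _ (*-monoʳ-≤ r (subst (λ t → t * g y ≤ ∑ᴸ ys g) l≡ le)) ⟩
      r * ∑ᴸ ys g + r * (suc l * ∑ᴸ ys g)    ≡⟨ collect (suc l) r (∑ᴸ ys g) ⟩
      suc (suc l) * (r * ∑ᴸ ys g)
        ≤⟨ *-monoʳ-≤ (suc (suc l)) (subst (λ t → r * ∑ᴸ ys g ≤ t * ∑ᴸ zs g) l≡ le′) ⟩
      suc (suc l) * (suc l * ∑ᴸ zs g)        ≡⟨ exchange-* (suc (suc l)) (suc l) (∑ᴸ zs g) ⟩
      suc l * (suc (suc l) * ∑ᴸ zs g)        ≡⟨ cong (λ t → suc l * (suc t * ∑ᴸ zs g)) (trans (sym l≡) len) ⟩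
      suc l * (suc (length xs) * ∑ᴸ zs g)    ∎)
      where
      expand : ∀ a r b c → a * (r * (b + c)) ≡ r * (a * b) + r * (a * c)
      expand = solve-∀
      collect : ∀ a r c → r * c + r * (a * c) ≡ suc a * (r * c)
      collect = solve-∀
      exchange-* : ∀ a b c → a * (b * c) ≡ b * (a * c)
      exchange-* = solve-∀

-- The inductive step

module Step {m k : ℕ} (G : Tree (suc m) (suc (suc k))) where

  private
    M = suc m
    κ = suc (suc k)

  cut volume : Subset M → ℕ
  cut α = ∑ κ (λ τ → ι (fillσ G τ α))
  volume σ = vol κ (fillσ G σ)

  -- Both sides count the pairs of `τ` and `α` with α ∈ Fill(τ, G).
  ∑-cut : ∑ κ cut ≡ total G
  ∑-cut = ∑-swap κ κ (λ α τ → ι (fillσ G τ α))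

  cut-outside : ∀ α → has G α ≡ false → cut α ≡ 0
  cut-outside α e = trans
    (∑-cong {M} κ (λ τ q → cong ι (¬-not (λ f → false≢true e (fillσ⊑ G τ q α f))))) (∑-zero {M} κ)

  -- A good relabelling makes `W` at least the square of `total G` divided by `M C κ`. Keeping the
  -- best `r` of the `m C suc k` simplices of `G` retains the fraction r / (m C suc k) of `W`. What
  -- is kept is a lower bound for `mixed R Q`, which the tower multiplies by `j`.
  step : ∀ r → r ≤ m C suc k → ∀ j →
         Σ (Tree (j + (r + M)) (suc κ)) λ T → j * r * (total G * total G) ≤ (m C suc k) * (M C κ) * total T
  step r r≤N j with goodRelabelling κ cut volume
  ... | φ , φ-good with selectBest (λ α → cut α * volume (to φ α)) r (m C suc k ∸ r) (elements κ (has G))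
                          (trans (trans (length-elements κ (has G)) (count G)) (sym (m∸n+n≡m r≤N)))
  ... | αs , sub , refl , best = Floor.T F , bound
    where
    H = relabel G φ
    open Subdivisions G H
    open Stage (stage αs (All-resp-⊆ sub (elements-∈ κ (has G))) (Unique-resp-⊆ sub (elements-unique κ (has G))))
    open Tower R Q (treeUp r (star m k))
    F = floor j
    N = m C suc k
    a = total G
    W = ∑ κ (λ α → cut α * volume (to φ α))
    W′ = ∑ᴸ αs (λ α → cut α * volume (to φ α))
    elements-W : ∑ᴸ (elements κ (has G)) (λ α → cut α * volume (to φ α)) ≡ W
    elements-W = trans (∑ᴸ-elements κ (has G) _) (∑-cong {M} κ λ α _ → drop α)
      where
      drop : ∀ α → ι (has G α) * (cut α * volume (to φ α)) ≡ cut α * volume (to φ α)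
      drop α with has G α in e
      ... | true  = +-identityʳ _
      ... | false = cong (_* volume (to φ α)) (sym (cut-outside α e))
    ∑-weight : W′ ≡ ∑ κ (weight αs)
    ∑-weight = trans (gains αs (All-resp-⊆ sub (elements-∈ κ (has G)))) (∑ᴸ-∑ κ αs (λ α τ → ι (fillσ G τ α) * gain α))
      where
      gains : ∀ βs → All (λ α → has G α ≡ true) βs →
              ∑ᴸ βs (λ α → cut α * volume (to φ α)) ≡ ∑ᴸ βs (λ α → ∑ κ (λ τ → ι (fillσ G τ α) * gain α))
      gains []       _        = refl
      gains (β ∷ βs) (Gβ ∷ p) = cong₂ _+_
        (trans (cong (cut β *_) (sym (vol-fillσ-relabel G φ β (uniform G β Gβ))))
               (sym (∑-*ʳ κ (gain β) (λ τ → ι (fillσ G τ β)))))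
        (gains βs p)
    -- At the last stage the auxiliary cycle `y` is zero, and only the `τ` on the first `M` vertices
    -- are counted.
    mixed-weight : ∑ κ (weight αs) ≤ mixed R Q
    mixed-weight = ≤-trans (∑-mono κ λ τ q →
      ≤-trans (gained τ q 𝟘 (λ _ ()) bd-𝟘) (≤-reflexive (vol-cong (suc κ) (≈-sym
        (fill-cong R (uniform-below (fundamental-uniform Q (up r τ) (trans (card-up r τ) q)))
                     (fundamental-cycle Q (up r τ) (trans (card-up r τ) q))
                     (λ t → sym (trans (cong ((δ (up r τ) ⊕ fillσ Q (up r τ)) t xor_) (upᶜ-𝟘 r t))
                                       (xor-identityʳ _))))))))
      (∑-up r κ (λ τ → vol (suc κ) (fill R (δ τ ⊕ fillσ Q τ))))
    open ≤-Reasoning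
    bound : j * r * (a * a) ≤ N * (M C κ) * total (Floor.T F)
    bound = begin
      j * r * (a * a)            ≤⟨ *-monoʳ-≤ (j * r) (subst (λ b → b * a ≤ W * (M C κ)) ∑-cut φ-good) ⟩
      j * r * (W * (M C κ))      ≡⟨ regroup j r W (M C κ) ⟩
      j * (r * W) * (M C κ)
        ≤⟨ *-monoˡ-≤ (M C κ) (*-monoʳ-≤ j (subst₂ (λ w l → r * w ≤ l * W′) elements-W
             (trans (length-elements κ (has G)) (count G)) best)) ⟩
      j * (N * W′) * (M C κ)     ≡⟨ regroup′ j N W′ (M C κ) ⟩
      N * (M C κ) * (j * W′)
        ≤⟨ *-monoʳ-≤ (N * (M C κ)) (*-monoʳ-≤ j (≤-trans (≤-reflexive ∑-weight) mixed-weight)) ⟩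
      N * (M C κ) * (j * mixed R Q) ≤⟨ *-monoʳ-≤ (N * (M C κ)) (Floor.large F) ⟩
      N * (M C κ) * total (Floor.T F) ∎
      where
      regroup : ∀ j r w c → j * r * (w * c) ≡ j * (r * w) * c
      regroup = solve-∀
      regroup′ : ∀ j n w c → j * (n * w) * c ≡ n * c * (j * w)
      regroup′ = solve-∀

-- Binomial coefficients

pascal : ∀ n k → suc n C suc k ≡ n C k + n C suc k
pascal n k = sym (nCk+nC[k+1]≡[n+1]C[k+1] n k)

absorption : ∀ n k → suc k * (suc n C suc k) ≡ suc n * (n C k)
absorption zero    zero    = refl
absorption zero    (suc k) = *-zeroʳ (suc (suc k))
absorption (suc n) zero    = trans (+-identityʳ _) (trans (nC1≡n (suc (suc n))) (sym (*-identityʳ _)))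
absorption (suc n) (suc k) = begin
  suc (suc k) * (suc (suc n) C suc (suc k))   ≡⟨ cong (suc (suc k) *_) (pascal (suc n) (suc k)) ⟩
  suc (suc k) * (a + (suc n C suc (suc k)))   ≡⟨ *-distribˡ-+ (suc (suc k)) a _ ⟩
  a + suc k * a + suc (suc k) * (suc n C suc (suc k))
    ≡⟨ cong₂ (λ x y → a + x + y) (absorption n k) (absorption n (suc k)) ⟩
  a + suc n * (n C k) + suc n * (n C suc k)   ≡⟨ +-assoc a _ _ ⟩
  a + (suc n * (n C k) + suc n * (n C suc k)) ≡⟨ cong (a +_) (*-distribˡ-+ (suc n) (n C k) _) ⟨
  a + suc n * (n C k + n C suc k)             ≡⟨ cong (λ x → a + suc n * x) (pascal n k) ⟨
  suc (suc n) * a                             ∎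
  where
  open ≡-Reasoning
  a = suc n C suc k

C-step : ∀ n k → suc k * (n C suc k) ≡ (n ∸ k) * (n C k)
C-step n k = begin
  suc k * (n C suc k)                              ≡⟨ m+n∸n≡m _ (suc k * (n C k)) ⟨
  suc k * (n C suc k) + suc k * (n C k) ∸ suc k * (n C k)
    ≡⟨ cong (_∸ suc k * (n C k)) (trans (+-comm (suc k * (n C suc k)) _) (sym (*-distribˡ-+ (suc k) (n C k) _))) ⟩
  suc k * (n C k + n C suc k) ∸ suc k * (n C k)
    ≡⟨ cong (λ x → suc k * x ∸ suc k * (n C k)) (pascal n k) ⟨
  suc k * (suc n C suc k) ∸ suc k * (n C k)        ≡⟨ cong (_∸ suc k * (n C k)) (absorption n k) ⟩
  suc n * (n C k) ∸ suc k * (n C k)                ≡⟨ *-distribʳ-∸ (n C k) (suc n) (suc k) ⟨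
  (n ∸ k) * (n C k)                                ∎
  where open ≡-Reasoning

1≤C : ∀ {n k} → k ≤ n → 1 ≤ n C k
1≤C {n}     {zero}  _         = s≤s z≤n
1≤C {suc n} {suc k} (s≤s k≤n) = ≤-trans (1≤C k≤n) (≤-trans (m≤m+n _ _) (≤-reflexive (sym (pascal n k))))

-- It guarantees that the tree on the first third has as many simplices as there are vertices in the
-- second third.
n≤C : ∀ {n k} → suc k < n → n ≤ n C suc k
n≤C {n}     {zero}  _          = ≤-reflexive (sym (nC1≡n n))
n≤C {suc n} {suc k} (s≤s k+1<n) = ≤-trans (≤-reflexive (+-comm 1 n))
  (≤-trans (+-mono-≤ (n≤C k+1<n) (1≤C k+1<n)) (≤-reflexive (sym (pascal n (suc k)))))

C≤2^ : ∀ n k → n C k ≤ 2 ^ n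
C≤2^ zero    zero    = ≤-refl
C≤2^ zero    (suc k) = z≤n
C≤2^ (suc n) zero    = m^n>0 2 (suc n)
C≤2^ (suc n) (suc k) = ≤-trans (≤-reflexive (pascal n k))
  (+-mono-≤ (C≤2^ n k) (≤-trans (C≤2^ n (suc k)) (≤-reflexive (sym (+-identityʳ _)))))

-- After multiplication by e! both binomials are products of `e` factors, and n - i is at most four
-- times m - i while i stays below about a third of `m`.
C-ratio : ∀ {m n} e → n ≤ 3 * m + 1 → 3 * e ≤ m + 2 → n C e ≤ 4 ^ e * (m C e)
C-ratio         zero    _   _ = ≤-refl
C-ratio {m} {n} (suc e) n≤ e≤ = *-cancelˡ-≤ (suc e) (begin
  suc e * (n C suc e)                ≡⟨ C-step n e ⟩
  (n ∸ e) * (n C e)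
    ≤⟨ *-mono-≤ difference (C-ratio e n≤ (≤-trans (*-monoʳ-≤ 3 (n≤1+n e)) e≤)) ⟩
  4 * (m ∸ e) * (4 ^ e * (m C e))    ≡⟨ regroup (m ∸ e) (4 ^ e) (m C e) ⟩
  4 * 4 ^ e * ((m ∸ e) * (m C e))    ≡⟨ cong (4 * 4 ^ e *_) (C-step m e) ⟨
  4 * 4 ^ e * (suc e * (m C suc e))  ≡⟨ regroup′ (4 * 4 ^ e) (suc e) (m C suc e) ⟩
  suc e * (4 ^ suc e * (m C suc e))  ∎)
  where
  open ≤-Reasoning
  regroup : ∀ a b c → 4 * a * (b * c) ≡ 4 * b * (a * c)
  regroup = solve-∀
  regroup′ : ∀ a b c → a * (b * c) ≡ b * (a * c)
  regroup′ = solve-∀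
  3e+1≤m : 3 * e + 1 ≤ m
  3e+1≤m = +-cancelʳ-≤ 2 _ _ (≤-trans (≤-reflexive (shift e)) e≤)
    where
    shift : ∀ e → 3 * e + 1 + 2 ≡ 3 * suc e
    shift = solve-∀
  t = m ∸ e
  e+t≡m : e + t ≡ m
  e+t≡m = m+[n∸m]≡n (≤-trans (m≤m+n e (e + (e + 0))) (≤-trans (m≤m+n _ 1) 3e+1≤m))
  2e+1≤t : 2 * e + 1 ≤ t
  2e+1≤t = +-cancelˡ-≤ e _ _ (≤-trans (≤-reflexive (sym (+-assoc e _ 1))) (≤-trans 3e+1≤m (≤-reflexive (sym e+t≡m))))
  difference : n ∸ e ≤ 4 * t
  difference = begin
    n ∸ e                        ≤⟨ ∸-monoˡ-≤ e n≤ ⟩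
    3 * m + 1 ∸ e                ≡⟨ cong (λ x → 3 * x + 1 ∸ e) e+t≡m ⟨
    3 * (e + t) + 1 ∸ e          ≡⟨ cong (_∸ e) (split e t) ⟩
    e + (2 * e + 1 + 3 * t) ∸ e  ≡⟨ m+n∸m≡n e _ ⟩
    2 * e + 1 + 3 * t            ≤⟨ +-monoˡ-≤ (3 * t) 2e+1≤t ⟩
    4 * t                        ∎
    where
    split : ∀ e t → 3 * (e + t) + 1 ≡ e + (2 * e + 1 + 3 * t)
    split = solve-∀

n<3^n : ∀ n → suc n ≤ 3 ^ n
n<3^n zero    = ≤-refl
n<3^n (suc n) = begin
  suc (suc n)  ≤⟨ m≤m+n (suc (suc n)) (2 * n + 1) ⟩
  suc (suc n) + (2 * n + 1)  ≡⟨ triple n ⟩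
  3 * suc n    ≤⟨ *-monoʳ-≤ 3 (n<3^n n) ⟩
  3 ^ suc n    ∎
  where
  open ≤-Reasoning
  triple : ∀ n → suc (suc n) + (2 * n + 1) ≡ 3 * suc n
  triple = solve-∀

-- c_d = 16 / D (d - 1)
D : ℕ → ℕ
D k = 48 ^ (3 ^ k)

D-suc : ∀ k → D (suc k) ≡ D k * (D k * D k)
D-suc k = begin
  48 ^ (3 * 3 ^ k)                          ≡⟨ ^-distribˡ-+-* 48 (3 ^ k) _ ⟩
  D k * 48 ^ (3 ^ k + (3 ^ k + 0))          ≡⟨ cong (λ x → D k * 48 ^ (3 ^ k + x)) (+-identityʳ (3 ^ k)) ⟩
  D k * 48 ^ (3 ^ k + 3 ^ k)                ≡⟨ cong (D k *_) (^-distribˡ-+-* 48 (3 ^ k) (3 ^ k)) ⟩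
  D k * (D k * D k)                         ∎
  where open ≡-Reasoning

16^≤D : ∀ k → let e = suc (suc k) in 16 ^ e ≤ 4 * (e * suc e) * D k
16^≤D k = begin
  -- The number 24 = 4 * 2 * 3 is the least value of the factor 4 * (e * suc e).
  16 * 16 ^ suc k         ≤⟨ *-mono-≤ {16} {24} (m≤m+n 16 8) (^-monoˡ-≤ (suc k) {16} {48} (m≤m+n 16 32)) ⟩
  24 * 48 ^ suc k         ≤⟨ *-mono-≤ (*-monoʳ-≤ 4 (*-mono-≤ {2} {suc (suc k)} {3} {suc (suc (suc k))}
                                        (s≤s (s≤s z≤n)) (s≤s (s≤s (s≤s z≤n)))))
                                      (^-monoʳ-≤ 48 (n<3^n k)) ⟩
  4 * (suc (suc k) * suc (suc (suc k))) * D k ∎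
  where open ≤-Reasoning

-- The thirds have `suc m`, `m` and `j` vertices, the last taking the remainder `s`. Absorption
-- turns both binomials on the left into `n C e`, and passing to `suc m C e` costs `4 ^ e` each
-- time; `D k` pays for the resulting power of 16.
binomial-bound : ∀ k m s n → let e = suc (suc k); j = suc (suc m) + s in
  s ≤ 2 → suc n ≡ 3 * suc m + s → 3 * k + 4 ≤ suc m →
  (n C e) * (suc n C suc e) ≤ 16 * (j * m) * ((m C suc k) * (suc m C e)) * D k
binomial-bound k m s n s≤2 n≡ k≤ = *-cancelˡ-≤ (e * suc e) (begin
  e * suc e * (A * B)                  ≡⟨ regroup₁ e (suc e) A B ⟩
  e * (A * (suc e * B))                ≡⟨ cong (λ x → e * (A * x)) (absorption n e) ⟩
  e * (A * (suc n * A))                ≤⟨ *-monoʳ-≤ e (*-mono-≤ A≤ (*-monoʳ-≤ (suc n) A≤)) ⟩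
  e * (4 ^ e * M * (suc n * (4 ^ e * M))) ≡⟨ regroup₂ e (4 ^ e) M (suc n) ⟩
  4 ^ e * 4 ^ e * M * suc n * (e * M)  ≡⟨ cong₂ (λ x y → x * M * suc n * y) (sym 16^e) (absorption m (suc k)) ⟩
  16 ^ e * M * suc n * (suc m * N)     ≡⟨ regroup₃ (16 ^ e) M (suc n) (suc m) N ⟩
  16 ^ e * (suc n * suc m) * (N * M)   ≤⟨ *-monoˡ-≤ (N * M) (*-mono-≤ (16^≤D k) sides) ⟩
  4 * (e * suc e) * D k * (4 * (j * m)) * (N * M) ≡⟨ regroup₄ (e * suc e) (D k) (j * m) (N * M) ⟩
  e * suc e * (16 * (j * m) * (N * M) * D k) ∎)
  where
  open ≤-Reasoning
  e = suc (suc k)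
  j = suc (suc m) + s
  A = n C e
  B = suc n C suc e
  N = m C suc k
  M = suc m C e
  16^e : 16 ^ e ≡ 4 ^ e * 4 ^ e
  16^e = trans (^-*-assoc 4 2 e) (trans (cong (λ x → 4 ^ (e + x)) (+-identityʳ e)) (^-distribˡ-+-* 4 e e))
  regroup₁ : ∀ e f a b → e * f * (a * b) ≡ e * (a * (f * b))
  regroup₁ = solve-∀
  regroup₂ : ∀ e q m n → e * (q * m * (n * (q * m))) ≡ q * q * m * n * (e * m)
  regroup₂ = solve-∀
  regroup₃ : ∀ q M n m N → q * M * n * (m * N) ≡ q * (n * m) * (N * M)
  regroup₃ = solve-∀
  regroup₄ : ∀ f d j c → 4 * f * d * (4 * j) * c ≡ f * (16 * j * c * d)
  regroup₄ = solve-∀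
  A≤ : A ≤ 4 ^ e * M
  A≤ = C-ratio {suc m} e (s≤s⁻¹ (≤-trans (≤-reflexive n≡)
                           (≤-trans (+-monoʳ-≤ (3 * suc m) s≤2) (≤-reflexive (+-suc (3 * suc m) 1)))))
                 (≤-trans (≤-reflexive (shift k)) (+-monoˡ-≤ 2 k≤))
    where
    shift : ∀ k → 3 * suc (suc k) ≡ 3 * k + 4 + 2
    shift = solve-∀
  3≤m : 3 ≤ m
  3≤m = +-cancelˡ-≤ 1 _ _ (≤-trans (m≤n+m 4 (3 * k)) k≤)
  sides : suc n * suc m ≤ 4 * (j * m)
  sides = begin
    suc n * suc m           ≡⟨ cong (_* suc m) n≡ ⟩
    (3 * suc m + s) * suc m ≤⟨ *-monoˡ-≤ (suc m) (+-mono-≤ (*-monoʳ-≤ 3 (n≤1+n (suc m))) (m≤m+n s (s + (s + 0)))) ⟩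
    (3 * suc (suc m) + 3 * s) * suc m ≡⟨ cong (_* suc m) (*-distribˡ-+ 3 (suc (suc m)) s) ⟨
    3 * j * suc m           ≡⟨ split j m ⟩
    j * (3 + 3 * m)         ≤⟨ *-monoʳ-≤ j (+-monoˡ-≤ (3 * m) 3≤m) ⟩
    j * (m + 3 * m)         ≡⟨ collect j m ⟩
    4 * (j * m)             ∎
    where
    split : ∀ j m → 3 * j * suc m ≡ j * (3 + 3 * m)
    split = solve-∀
    collect : ∀ j m → j * (m + 3 * m) ≡ 4 * (j * m)
    collect = solve-∀

-- Here c_d times C(n, d) is at most 1, so every hypertree is good enough. The number 5 is the
-- exponent in 2 ^ 5 = 32 ≤ 48, and the 4 accounts for the factor 16.
small-bound : ∀ k n → n + 4 ≤ 5 * 3 ^ suc k → 16 * (n C suc (suc k)) ≤ D (suc k)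
small-bound k n le = begin
  16 * (n C suc (suc k))  ≤⟨ *-monoʳ-≤ 16 (C≤2^ n (suc (suc k))) ⟩
  2 ^ 4 * 2 ^ n           ≡⟨ *-comm (2 ^ 4) (2 ^ n) ⟩
  2 ^ n * 2 ^ 4           ≡⟨ ^-distribˡ-+-* 2 n 4 ⟨
  2 ^ (n + 4)             ≤⟨ ^-monoʳ-≤ 2 le ⟩
  2 ^ (5 * 3 ^ suc k)     ≡⟨ ^-*-assoc 2 5 (3 ^ suc k) ⟨
  32 ^ 3 ^ suc k          ≤⟨ ^-monoˡ-≤ (3 ^ suc k) (m≤m+n 32 16) ⟩
  D (suc k)               ∎
  where open ≤-Reasoning

-- The bound by induction on the dimension

Large : (n k : ℕ) → Set
Large n k = Σ (Tree (suc n) (suc (suc k))) λ T → 16 * (n C suc k) * (suc n C suc (suc k)) ≤ total T * D k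

-- In dimension one the constant is 16 / 48 = 1 / 3, and the mean distance on the path is (n + 2) /
-- 3.
large-path : ∀ n → Large n 0
large-path n = path n , (begin
  16 * (n C 1) * (suc n C 2)    ≡⟨ cong (λ x → 16 * x * (suc n C 2)) (nC1≡n n) ⟩
  16 * n * (suc n C 2)          ≡⟨ regroup n (suc n C 2) ⟩
  8 * (n * (2 * (suc n C 2)))   ≡⟨ cong (λ x → 8 * (n * x)) (trans (absorption n 1) (cong (suc n *_) (nC1≡n n))) ⟩
  8 * (n * (suc n * n))         ≤⟨ *-monoʳ-≤ 8 (*-monoʳ-≤ n (*-monoʳ-≤ (suc n) (≤-trans (n≤1+n n) (n≤1+n (suc n))))) ⟩
  8 * (n * (suc n * suc (suc n))) ≡⟨ cong (8 *_) (*-assoc n (suc n) _) ⟨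
  8 * (n * suc n * suc (suc n)) ≤⟨ *-monoʳ-≤ 8 (path-total n) ⟩
  8 * (6 * total (path n))      ≡⟨ *-comm-48 (total (path n)) ⟩
  total (path n) * 48           ∎)
  where
  open ≤-Reasoning
  regroup : ∀ n c → 16 * n * c ≡ 8 * (n * (2 * c))
  regroup = solve-∀
  *-comm-48 : ∀ t → 8 * (6 * t) ≡ t * 48
  *-comm-48 = solve-∀

large-small : ∀ k n → n + 4 ≤ 5 * 3 ^ suc k → Large n (suc k)
large-small k n le = T ,
  ≤-trans (*-mono-≤ (small-bound k n le) (total-trivial T)) (≤-reflexive (*-comm (D (suc k)) (total T)))
  where
  T = star n (suc (suc k))

-- Of the three factors `D k` in `D (suc k)`, two come from the bound for `G`, whose total enters
-- squared, and the third pays for the comparison of binomials. Hence the exponent triples with each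
-- dimension.
large-sum : ∀ k m s n → suc n ≡ suc (suc m) + s + (m + suc m) → s ≤ 2 → 3 * k + 4 ≤ suc m →
            Large m k → Large n (suc k)
large-sum k m s n refl s≤2 k≤ (G , G-large) with Step.step G m (n≤C k<m) (suc (suc m) + s)
  where
  k<m : suc k < m
  k<m = +-cancelˡ-≤ 1 _ _ (≤-trans (≤-trans (m≤m+n (3 + k) (2 * k + 1)) (≤-reflexive (shift k))) k≤)
    where
    shift : ∀ k → 3 + k + (2 * k + 1) ≡ 3 * k + 4
    shift = solve-∀
... | T , T-large = T , *-cancelˡ-≤ (N * M) {{>-nonZero NM>0}} (begin
  N * M * (16 * A * B)                             ≡⟨ regroup₁ (N * M) A B ⟩
  16 * (N * M) * (A * B)
    ≤⟨ *-monoʳ-≤ (16 * (N * M)) (binomial-bound k m s n s≤2 (n≡ m s) k≤) ⟩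
  16 * (N * M) * (16 * (j * m) * (N * M) * D k)    ≡⟨ regroup₂ (N * M) (j * m) (D k) ⟩
  D k * (j * m) * ((16 * (N * M)) * (16 * (N * M))) ≤⟨ *-monoʳ-≤ (D k * (j * m)) (*-mono-≤ G≥ G≥) ⟩
  D k * (j * m) * ((a * D k) * (a * D k))          ≡⟨ regroup₃ (D k) (j * m) a ⟩
  j * m * (a * a) * (D k * (D k * D k))            ≤⟨ *-monoˡ-≤ (D k * (D k * D k)) T-large ⟩
  N * M * total T * (D k * (D k * D k))            ≡⟨ cong (N * M * total T *_) (D-suc k) ⟨
  N * M * total T * D (suc k)                      ≡⟨ *-assoc (N * M) (total T) (D (suc k)) ⟩
  N * M * (total T * D (suc k))                    ∎)
  where
  open ≤-Reasoning
  e = suc (suc k)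
  j = suc (suc m) + s
  A = n C e
  B = suc n C suc e
  N = m C suc k
  M = suc m C e
  a = total G
  G≥ : 16 * (N * M) ≤ a * D k
  G≥ = ≤-trans (≤-reflexive (sym (*-assoc 16 N M))) G-large
  e≤1+m : e ≤ suc m
  e≤1+m = ≤-trans (≤-trans (m≤m+n e (2 * k + 2)) (≤-reflexive (shift k))) k≤
    where
    shift : ∀ k → suc (suc k) + (2 * k + 2) ≡ 3 * k + 4
    shift = solve-∀
  NM>0 : 1 ≤ N * M
  NM>0 = *-mono-≤ (1≤C (s≤s⁻¹ e≤1+m)) (1≤C e≤1+m)
  n≡ : ∀ m s → suc (suc m) + s + (m + suc m) ≡ 3 * suc m + s
  n≡ = solve-∀
  regroup₁ : ∀ c a b → c * (16 * a * b) ≡ 16 * c * (a * b)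
  regroup₁ = solve-∀
  regroup₂ : ∀ c j d → 16 * c * (16 * j * c * d) ≡ d * j * ((16 * c) * (16 * c))
  regroup₂ = solve-∀
  regroup₃ : ∀ d j a → d * j * ((a * d) * (a * d)) ≡ j * (a * a) * (d * (d * d))
  regroup₃ = solve-∀

large-big : ∀ k n → 5 * 3 ^ suc k < n + 4 → (∀ m → Large m k) → Large n (suc k)
large-big k n lt hyp = split (suc n / 3) (suc n % 3) (s≤s⁻¹ (m%n<n (suc n) 3))
  (trans (m≡m%n+[m/n]*n (suc n) 3) (rearrange (suc n % 3) (suc n / 3)))
  where
  rearrange : ∀ a b → a + b * 3 ≡ 3 * b + a
  rearrange = solve-∀
  split : ∀ q s → s ≤ 2 → suc n ≡ 3 * q + s → Large n (suc k)
  split q s s≤2 n≡ = go q n≡ q≥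
    where
    -- By 3 ^ k ≥ k + 1 the lower bound on `n` gives 3 * (3 * k + 3) < 3 * q.
    q≥ : 3 * k + 4 ≤ q
    q≥ = ≤-trans (≤-reflexive (+-suc (3 * k) 3)) (*-cancelˡ-< 3 _ _ (+-cancelʳ-≤ 5 _ _ (begin
      suc (3 * (3 * k + 3)) + 5           ≤⟨ m≤m+n _ (6 * k + 1) ⟩
      suc (3 * (3 * k + 3)) + 5 + (6 * k + 1) ≡⟨ shift k ⟩
      suc (5 * (3 * suc k))   ≤⟨ s≤s (*-monoʳ-≤ 5 (*-monoʳ-≤ 3 (n<3^n k))) ⟩
      suc (5 * 3 ^ suc k)     ≤⟨ lt ⟩
      n + 4                   ≡⟨ +-suc n 3 ⟩
      suc n + 3               ≡⟨ cong (_+ 3) n≡ ⟩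
      3 * q + s + 3           ≤⟨ +-monoˡ-≤ 3 (+-monoʳ-≤ (3 * q) s≤2) ⟩
      3 * q + 2 + 3           ≡⟨ +-assoc (3 * q) 2 3 ⟩
      3 * q + 5               ∎)))
      where
      open ≤-Reasoning
      shift : ∀ k → suc (3 * (3 * k + 3)) + 5 + (6 * k + 1) ≡ suc (5 * (3 * suc k))
      shift = solve-∀
    go : ∀ q → suc n ≡ 3 * q + s → 3 * k + 4 ≤ q → Large n (suc k)
    go zero    _  le = case ≤-trans (m≤n+m 4 (3 * k)) le of λ ()
    go (suc m) n≡ le = large-sum k m s n (trans n≡ (shape m s)) s≤2 le (hyp m)
      where
      shape : ∀ m s → 3 * suc m + s ≡ suc (suc m) + s + (m + suc m)
      shape = solve-∀

large : ∀ k n → Large n k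
large zero    n = large-path n
large (suc k) n with n + 4 ≤? 5 * 3 ^ suc k
... | yes le = large-small k n le
... | no ¬le = large-big k n (≰⇒> ¬le) (large k)

-- Comparison with the chains of Defs

∑ᴸ-filter : {P : I → Set} (P? : Decidable P) (xs : List I) (f : I → ℕ) →
            ∑ᴸ (filter P? xs) f ≡ ∑ᴸ xs (λ x → if does (P? x) then f x else 0)
∑ᴸ-filter P? []       f = refl
∑ᴸ-filter P? (x ∷ xs) f with does (P? x)
... | true  = cong (f x +_) (∑ᴸ-filter P? xs f)
... | false = ∑ᴸ-filter P? xs f

∑ᴸ-subsets : ∀ k (f : Subset n → ℕ) → ∑ᴸ (subsets n) (λ s → if ∣ s ∣ ≡ᵇ k then f s else 0) ≡ ∑ k f
∑ᴸ-subsets {zero}  zero    f = +-identityʳ _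
∑ᴸ-subsets {zero}  (suc k) f = refl
∑ᴸ-subsets {suc n} zero    f = trans (∑ᴸ-++ (map (outside ∷_) (subsets n)) _ _)
  (trans (cong₂ _+_ (trans (∑ᴸ-map (outside ∷_) (subsets n) _) (∑ᴸ-subsets 0 (f ∘ (outside ∷_))))
                    (trans (∑ᴸ-map (inside ∷_) (subsets n) _)
                           (trans (∑ᴸ-const (subsets n) 0) (*-zeroʳ (length (subsets n))))))
         (+-identityʳ _))
∑ᴸ-subsets {suc n} (suc k) f = trans (∑ᴸ-++ (map (outside ∷_) (subsets n)) _ _)
  (cong₂ _+_ (trans (∑ᴸ-map (outside ∷_) (subsets n) _) (∑ᴸ-subsets (suc k) (f ∘ (outside ∷_))))
             (trans (∑ᴸ-map (inside ∷_) (subsets n) _) (∑ᴸ-subsets k (f ∘ (inside ∷_)))))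

∑ᴸ-K : ∀ d (f : Subset n → ℕ) → ∑ᴸ (K n d) f ≡ ∑ (suc d) f
∑ᴸ-K {n} d f = trans (∑ᴸ-filter (λ s → ∣ s ∣ ≟ suc d) (subsets n) f) (∑ᴸ-subsets (suc d) f)

⊻ : (Subset n → Bool) → Bool
⊻ {zero}  f = f []
⊻ {suc n} f = ⊻ (f ∘ (outside ∷_)) xor ⊻ (f ∘ (inside ∷_))

⊻-cong : {f g : Subset n → Bool} → (∀ s → f s ≡ g s) → ⊻ f ≡ ⊻ g
⊻-cong {zero}  e = e []
⊻-cong {suc n} e = cong₂ _xor_ (⊻-cong (e ∘ (outside ∷_))) (⊻-cong (e ∘ (inside ∷_)))

⊻-false : {f : Subset n → Bool} → (∀ s → f s ≡ false) → ⊻ f ≡ false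
⊻-false {zero}  e = e []
⊻-false {suc n} e = cong₂ _xor_ (⊻-false (e ∘ (outside ∷_))) (⊻-false (e ∘ (inside ∷_)))

parity-++ : ∀ bs cs → parity (bs ++ cs) ≡ parity bs xor parity cs
parity-++ []       cs = refl
parity-++ (b ∷ bs) cs = trans (cong (b xor_) (parity-++ bs cs)) (sym (xor-assoc b (parity bs) (parity cs)))

parity-filter : {P : I → Set} (P? : Decidable P) (xs : List I) (f : I → Bool) →
                parity (map f (filter P? xs)) ≡ parity (map (λ x → does (P? x) ∧ f x) xs)
parity-filter P? []       f = refl
parity-filter P? (x ∷ xs) f with does (P? x)
... | true  = cong (f x xor_) (parity-filter P? xs f)
... | false = parity-filter P? xs f

parity-subsets : (f : Subset n → Bool) → parity (map f (subsets n)) ≡ ⊻ f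
parity-subsets {zero}  f = xor-identityʳ _
parity-subsets {suc n} f = trans (cong parity (map-++ f (map (outside ∷_) (subsets n)) _))
  (trans (parity-++ (map f (map (outside ∷_) (subsets n))) _)
  (cong₂ _xor_ (trans (cong parity (sym (map-∘ (subsets n)))) (parity-subsets (f ∘ (outside ∷_))))
               (trans (cong parity (sym (map-∘ (subsets n)))) (parity-subsets (f ∘ (inside ∷_))))))

face : Subset n → Subset n → Bool
face τ σ = does (τ ⊆? σ)

face-card : (τ σ : Subset n) → face τ σ ≡ true → ∣ τ ∣ ≤ ∣ σ ∣
face-card []            []            _ = z≤n
face-card (outside ∷ τ) (outside ∷ σ) e = face-card τ σ e
face-card (outside ∷ τ) (inside  ∷ σ) e = m≤n⇒m≤1+n (face-card τ σ e)
face-card (inside  ∷ τ) (inside  ∷ σ) e = s≤s (face-card τ σ e)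

-- Among the sets of the cardinality of `τ` only `τ` itself contains `τ`.
⊻-face : (X : Chain n) (τ : Subset n) → Uniform ∣ τ ∣ X → ⊻ (λ σ → X σ ∧ face τ σ) ≡ X τ
⊻-face X []            u = ∧-identityʳ _
⊻-face X (outside ∷ τ) u =
  trans (cong₂ _xor_ (⊻-face (deletion X) τ (u ∘ (outside ∷_))) (⊻-false empty-link)) (xor-identityʳ _)
  where
  empty-link : ∀ σ → X (inside ∷ σ) ∧ face τ σ ≡ false
  empty-link σ = ¬-not λ e → let Xσ , τ⊆σ = ∧-true e in
    1+n≰n (≤-trans (≤-reflexive (u (inside ∷ σ) Xσ)) (face-card τ σ τ⊆σ))
⊻-face X (inside  ∷ τ) u = cong₂ _xor_ (⊻-false (λ σ → ∧-zeroʳ (X (outside ∷ σ))))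
  (⊻-face (link X) τ (λ s e → suc-injective (u (inside ∷ s) e)))

-- If `τ` omits the top vertex, a set above it with one more element either omits that vertex too,
-- or is `τ` together with it. The first kind is covered by induction, the second by `⊻-face`.
⊻-bd : (X : Chain n) (τ : Subset n) → Uniform (suc ∣ τ ∣) X → ⊻ (λ σ → X σ ∧ face τ σ) ≡ bd X τ
⊻-bd X []            u = trans (∧-identityʳ _) (¬-not (λ e → case u [] e of λ ()))
⊻-bd X (outside ∷ τ) u = cong₂ _xor_ (⊻-bd (deletion X) τ (u ∘ (outside ∷_)))
  (⊻-face (link X) τ (λ s e → suc-injective (u (inside ∷ s) e)))
⊻-bd X (inside  ∷ τ) u = cong₂ _xor_ (⊻-false (λ σ → ∧-zeroʳ (X (outside ∷ σ))))
  (⊻-bd (link X) τ (λ s e → suc-injective (u (inside ∷ s) e)))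

∂≈bd : ∀ d (X : Chain n) → Uniform (suc d) X → ∂ n d X ≈ bd X
∂≈bd {n} d X u τ with ∣ τ ∣ ≟ d
... | no ∣τ∣≢d = sym (¬-not (λ e → ∣τ∣≢d (suc-injective (bd-below u τ e))))
... | yes refl = begin
  parity (map f (K n d))                         ≡⟨ parity-filter (λ s → ∣ s ∣ ≟ suc d) (subsets n) f ⟩
  parity (map (λ σ → (∣ σ ∣ ≡ᵇ suc d) ∧ f σ) (subsets n)) ≡⟨ parity-subsets (λ σ → (∣ σ ∣ ≡ᵇ suc d) ∧ f σ) ⟩
  ⊻ (λ σ → (∣ σ ∣ ≡ᵇ suc d) ∧ f σ)             ≡⟨ ⊻-cong drop ⟩
  ⊻ (λ σ → X σ ∧ face τ σ)                       ≡⟨ ⊻-bd X τ u ⟩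
  bd X τ                                         ∎
  where
  open ≡-Reasoning
  f : Subset n → Bool
  f σ = X σ ∧ ⌊ τ ⊆? σ ⌋
  drop : ∀ σ → (∣ σ ∣ ≡ᵇ suc d) ∧ f σ ≡ X σ ∧ face τ σ
  drop σ with X σ in e
  ... | false = ∧-zeroʳ _
  ... | true  rewrite u σ e = cong₂ _∧_ (≡ᵇ-refl d) (isYes≗does (τ ⊆? σ))
    where
    ≡ᵇ-refl : ∀ d → (d ≡ᵇ d) ≡ true
    ≡ᵇ-refl zero    = refl
    ≡ᵇ-refl (suc d) = ≡ᵇ-refl d

single≈δ : (σ : Subset n) → single σ ≈ δ σ
single≈δ σ s with ≡-dec Bool._≟_ s σ
... | yes refl = sym (δ-refl s)
... | no s≢σ   = sym (δ≡false σ s s≢σ)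

module _ (T : Tree n (suc k)) where

  has-forest : IsForest n k (has T)
  has-forest = uniform T , λ Y Y⊑T (s , Ys) ∂Y → false≢true
    (free T Y⊑T (≈-trans (≈-sym (∂≈bd k Y (λ t e → uniform T t (Y⊑T t e)))) ∂Y) s) Ys

  -- A simplex `σ` of `F` outside the tree would put the cycle σ + Fill(σ, T) inside `F`. This cycle
  -- is nonempty, since it contains `σ`.
  has-maximal : ∀ F → has T ⊑ F → IsForest n k F → F ⊑ has T
  has-maximal F T⊑F (F-uniform , F-free) σ Fσ with has T σ in Tσ
  ... | true  = refl
  ... | false = contradiction
    (≈-trans (∂≈bd k Z (fundamental-uniform T σ p)) (fundamental-cycle T σ p))
    (F-free Z (⊕-⊑ {X = δ σ} (λ s e → trans (cong F (δ⇒≡ σ s e)) Fσ) (λ s e → T⊑F s (fillσ⊑ T σ p s e)))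
              (σ , cong₂ _xor_ (δ-refl σ) (¬-not (λ e → false≢true Tσ (fillσ⊑ T σ p σ e)))))
    where
    p : ∣ σ ∣ ≡ suc k
    p = F-uniform σ Fσ
    Z : Chain n
    Z = δ σ ⊕ fillσ T σ

  has-hypertree : IsHypertree n k (has T)
  has-hypertree = has-forest , has-maximal

  fillσ-isFill : IsFill n k (has T) (fillσ T)
  fillσ-isFill σ p = fillσ⊑ T σ p , ≈-trans (∂≈bd k (fillσ T σ) (fillσ-uniform T σ p)) (≈-trans (bd-fillσ T σ p)
    (≈-sym (≈-trans (∂≈bd k (single σ) (λ s e → δ-uniform σ p s (trans (sym (single≈δ σ s)) e)))
                    (bd-cong (single≈δ σ)))))

  totalFill≡total : totalFill n k (fillσ T) ≡ total T
  totalFill≡total = trans (∑ᴸ-K k (λ σ → size n k (fillσ T σ)))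
    (∑-cong (suc k) (λ σ _ → ∑ᴸ-K k (λ s → ι (fillσ T σ s))))

theorem4 : (d n : ℕ) → 1 ≤ d → 1 ≤ n →
    Σ (Chain n) λ T → Σ (Subset n → Chain n) λ fill →
    IsHypertree n d T × IsFill n d T fill ×
    (16 * ((n ∸ 1) C d) * (n C suc d) ≤ totalFill n d fill * (48 ^ (3 ^ (d ∸ 1))))
theorem4 (suc k) (suc n) _ _ with large k n
... | T , T-large = has T , fillσ T , has-hypertree T , fillσ-isFill T ,
  subst (λ t → 16 * (n C suc k) * (suc n C suc (suc k)) ≤ t * 48 ^ (3 ^ k)) (sym (totalFill≡total T)) T-large
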